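{- Let $AP$ be a finite set of atomic propositions, $M$ an operator precedence matrix on $2^{AP}$, and $\varphi$ a POTL formula over $AP$. Let $H$ be a set of fresh normal (non-structural) atomic propositions not in $AP$, one for each hierarchical subformula of $\varphi$ (i.e. of the form $\bigcirc_H^\mu\psi$, $\ominus_H^\mu\psi$, $\psi\,\mathcal U_H^\mu\,\theta$ or $\psi\,\mathcal S_H^\mu\,\theta$), and let $M'$ be the matrix on $2^{AP\cup H}$ with $M'(a,b)=M(a\cap AP,b\cap AP)$. Then one can construct an operator precedence automaton $\mathcal A_\varphi$ over $(2^{AP\cup H},M')$ such that for every OP word $w$ over $AP$ (with matrix $M$): $(w,1)\models\varphi$ if and only if $\mathcal A_\varphi$ performs at least one accepting computation on some word $w'$ over $2^{AP\cup H}$ that is equal to $w$ except for the presence of propositions of $H$ (i.e. $w'$ has the same length and each letter of $w'$ intersected with $AP$ equals the corresponding letter of $w$).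
   Context: Let $AP$ be partitioned into normal propositions and structural labels, and let $\#\notin AP$ be an end marker; $\Sigma=2^{AP}$. An operator precedence matrix (OPM) $M$ on $\Sigma$ is a partial function $M:(\Sigma\cup\{\#\})^2\to\{\lessdot,\doteq,\gtrdot\}$, defined only on sets containing exactly one structural label, with $M(a,b)$ depending only on the structural labels in $a$ and $b$. Write $a\,\pi\,b$ for $M(a,b)=\pi$; by convention $\#\lessdot b$ for every $b$ and $a\gtrdot\#$ for every $a\in\Sigma$. A simple chain is a string $c_0c_1\dots c_\ell c_{\ell+1}$ with $\ell\ge1$, $c_0,c_{\ell+1}\in\Sigma\cup\{\#\}$, $c_1,\dots,c_\ell\in\Sigma$ and $c_0\lessdot c_1\doteq\dots\doteq c_\ell\gtrdot c_{\ell+1}$. A composed chain is a string $c_0s_0c_1s_1\dots c_\ell s_\ell c_{\ell+1}$ such that $c_0c_1\dots c_{\ell+1}$ is a simple chain and each $s_k\in\Sigma^*$ is either empty or such that $c_ks_kc_{k+1}$ is a chain; $(c_0,c_{\ell+1})$ is its context. A word $x\in\Sigma^*$ is compatible with $M$ if $M(c,d)$ is defined for consecutive letters $c,d$ of $x$ and $M(a,b)$ is defined for each substring of $\#x\#$ that is a chain with context $(a,b)$. An OP word is $w=\langle U,M,P\rangle$ with $U=\{0,\dots,n+1\}$, $P(0)=P(n+1)=\#$, $P(1)\cdots P(n)$ compatible with $M$; the OPA reads the word $P(1)\cdots P(n)$. Write $i\,\pi\,j$ if $P(i)\,\pi\,P(j)$. $\chi(i,j)$ holds iff $i<j-1$ and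 $P(i)\cdots P(j)$ is a chain. POTL formulas over $AP$: $\varphi::=a\mid\neg\varphi\mid\varphi\lor\varphi\mid\bigcirc^{\Pi}\varphi\mid\ominus^{\Pi}\varphi\mid\chi_F^{\Pi}\varphi\mid\chi_P^{\Pi}\varphi\mid\varphi\,\mathcal U_\chi^{\Pi}\,\varphi\mid\varphi\,\mathcal S_\chi^{\Pi}\,\varphi\mid\bigcirc_H^{\mu}\varphi\mid\ominus_H^{\mu}\varphi\mid\varphi\,\mathcal U_H^{\mu}\,\varphi\mid\varphi\,\mathcal S_H^{\mu}\,\varphi$, $a\in AP$, $\Pi\subseteq\{\lessdot,\doteq,\gtrdot\}$ nonempty, $\mu\in\{\lessdot,\gtrdot\}$. Semantics at position $i$ of $w$: $(w,i)\models a$ iff $a\in P(i)$; Booleans as usual. $\bigcirc^\Pi\varphi$: $i\,\pi\,(i+1)$ for some $\pi\in\Pi$ and $\varphi$ at $i+1$. $\ominus^\Pi\varphi$: $(i-1)\,\pi\,i$ for some $\pi\in\Pi$ and $\varphi$ at $i-1$. $\chi_F^\Pi\varphi$: some $j>i$ with $\chi(i,j)$, $i\,\pi\,j$ ($\pi\in\Pi$), $\varphi$ at $j$. $\chi_P^\Pi\varphi$: some $j<i$ with $\chi(j,i)$, $j\,\pi\,i$ ($\pi\in\Pi$), $\varphi$ at $j$. $\bigcirc_H^\lessdot\varphi$: some $h<i$ has $\chi(h,i)$, $h\lessdot i$, the set $\{k>i:\chi(h,k),h\lessdot k\}$ is nonempty and $\varphi$ holds at its minimum; $\ominus_H^\lessdot\varphi$: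 same with $\{k<i:\chi(h,k),h\lessdot k\}$, maximum. $\bigcirc_H^\gtrdot\varphi$: some $h>i$ has $\chi(i,h)$, $i\gtrdot h$, $\{k>i:\chi(k,h),k\gtrdot h\}$ nonempty and $\varphi$ at its minimum; $\ominus_H^\gtrdot\varphi$: same with $\{k<i:\chi(k,h),k\gtrdot h\}$, maximum. A path from $i$ to $j$ is $i=i_1<\dots<i_n=j$. For a set $\Gamma$ of paths, $(w,i)\models\varphi\,\mathcal U_\Gamma\,\psi$ iff for some $j\ge i$ a path in $\Gamma$ from $i$ to $j$ has $\varphi$ at $i_1,\dots,i_{n-1}$ and $\psi$ at $i_n$; $\varphi\,\mathcal S_\Gamma\,\psi$ iff for some $j\le i$ a path $j=i_1<\dots<i_n=i$ in $\Gamma$ has $\psi$ at $i_1$ and $\varphi$ at $i_2,\dots,i_n$. Summary path for $\Pi$: for each $p<n$, if $K_p=\{h\le j:\chi(i_p,h),\ i_p\,\pi\,h,\ \pi\in\Pi\}\ne\emptyset$ then $i_{p+1}=\max K_p$, else $i_{p+1}=i_p+1$ with $i_p\,\pi\,(i_p+1)$ for some $\pi\in\Pi$ (used by $\mathcal U_\chi^\Pi,\mathcal S_\chi^\Pi$). Yield-precedence hierarchical path: some $h<i$ has $\chi(h,i_p)$, $h\lessdot i_p$ for all $p$, no $k$ with $i_q<k<i_{q+1}$ and $\chi(h,k)$ (used by $\mathcal U_H^\lessdot,\mathcal S_H^\lessdot$). Take-precedence hierarchical path: some $h>j$ has $\chi(i_p,h)$, $i_p\gtrdot h$ for all $p$,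 no $k$ with $i_q<k<i_{q+1}$ and $\chi(k,h)$ (used by $\mathcal U_H^\gtrdot,\mathcal S_H^\gtrdot$). An operator precedence automaton (OPA) over $(\Sigma,M)$ is $\mathcal A=(\Sigma,M,Q,I,F,\delta)$ with finite $Q$, $I,F\subseteq Q$, $\delta=\delta_{push}\cup\delta_{shift}\cup\delta_{pop}$, $\delta_{push},\delta_{shift}\subseteq Q\times\Sigma\times Q$, $\delta_{pop}\subseteq Q\times Q\times Q$. Configurations $\langle x,q,\gamma\rangle$, $x\in\Sigma^*\#$, $\gamma\in(\Sigma\times Q)^*\bot$; the top symbol of $\gamma$ is the letter of its topmost pair, or $\#$ if $\gamma=\bot$. Moves ($b$ the next input symbol): push, if top $\lessdot b$: $\langle bx,p,\gamma\rangle\vdash\langle x,q,[b,p]\gamma\rangle$, $(p,b,q)\in\delta_{push}$; shift, if $a\doteq b$: $\langle bx,q,[a,p]\gamma\rangle\vdash\langle x,r,[b,p]\gamma\rangle$, $(q,b,r)\in\delta_{shift}$; pop, if $a\gtrdot b$: $\langle bx,q,[a,p]\gamma\rangle\vdash\langle bx,r,\gamma\rangle$, $(q,p,r)\in\delta_{pop}$. An accepting computation on $x$ is a sequence of moves $\langle x\#,q_I,\bot\rangle\vdash^*\langle\#,q_F,\bot\rangle$ with $q_I\in I$, $q_F\in F$. -}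

module Defs where

open import Data.Nat using (ℕ; zero; suc; _+_; _≤_; _<_)
open import Data.Fin using (Fin; zero; suc)
open import Data.Fin.Subset using (Subset)
open import Data.Bool using (Bool; true; false; _∧_; _∨_; T; if_then_else_; not)
open import Data.Maybe using (Maybe; just; nothing; Is-just)
import Data.Maybe as Maybe
open import Data.Vec using (Vec; []; _∷_; take)
open import Data.List using (List; []; _∷_; _++_; length; filterᵇ; deduplicateᵇ)
open import Data.Product using (Σ; _×_; _,_; ∃)
open import Data.Sum using (_⊎_)
open import Data.Empty using (⊥)
open import Data.Unit using (⊤)
open import Relation.Nullary using (¬_)
open import Relation.Nullary.Decidable using (⌊_⌋)
open import Relation.Binary.PropositionalEquality using (_≡_)
import Data.Fin as F

data Prec : Set where
  ⋖ ≐ ⋗ : Prec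

data HPrec : Set where
  yieldH takeH : HPrec

toPrec : HPrec → Prec
toPrec yieldH = ⋖
toPrec takeH  = ⋗

record PrecSet : Set where
  constructor precSet
  field
    hasY hasE hasT : Bool
    nonempty : T (hasY ∨ hasE ∨ hasT)

_∈P_ : Prec → PrecSet → Set
⋖ ∈P Π = T (PrecSet.hasY Π)
≐ ∈P Π = T (PrecSet.hasE Π)
⋗ ∈P Π = T (PrecSet.hasT Π)

-- AP = (k normal propositions, indexed by Fin k) ⊎ (m structural labels,
-- indexed by Fin m).  A letter of Σ = 2^AP is a pair of subsets.
Letter : ℕ → ℕ → Set
Letter k m = Subset k × Subset m

-- An OPM on 2^AP: M(a,b) is defined only when a and b each contain exactly
-- one structural label and depends only on those labels; so it is given by
-- a partial function on pairs of structural labels.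
Mat : ℕ → Set
Mat m = Fin m → Fin m → Maybe Prec

allFalse : ∀ {m} → Vec Bool m → Bool
allFalse [] = true
allFalse (b ∷ bs) = not b ∧ allFalse bs

theLabel : ∀ {m} → Vec Bool m → Maybe (Fin m)
theLabel [] = nothing
theLabel (true ∷ xs) = if allFalse xs then just zero else nothing
theLabel (false ∷ xs) = Maybe.map suc (theLabel xs)

precL : ∀ {k m} → Mat m → Letter k m → Letter k m → Maybe Prec
precL M (_ , s) (_ , t) with theLabel s | theLabel t
... | just l | just l' = M l l'
... | _      | _       = nothing

data Sym (k m : ℕ) : Set where
  hash : Sym k m
  sym  : Letter k m → Sym k m

precS : ∀ {k m} → Mat m → Sym k m → Sym k m → Maybe Prec
precS M hash    hash    = nothing
precS M hash    (sym b) = just ⋖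
precS M (sym a) hash    = just ⋗
precS M (sym a) (sym b) = precL M a b

data Formula (k m : ℕ) : Set where
  atom   : Fin k ⊎ Fin m → Formula k m
  ¬F     : Formula k m → Formula k m
  _∨F_   : Formula k m → Formula k m → Formula k m
  nextΠ  : PrecSet → Formula k m → Formula k m
  backΠ  : PrecSet → Formula k m → Formula k m
  χF     : PrecSet → Formula k m → Formula k m
  χP     : PrecSet → Formula k m → Formula k m
  Uχ     : PrecSet → Formula k m → Formula k m → Formula k m
  Sχ     : PrecSet → Formula k m → Formula k m → Formula k m
  nextH  : HPrec → Formula k m → Formula k m
  backH  : HPrec → Formula k m → Formula k m
  UH     : HPrec → Formula k m → Formula k m → Formula k m
  SH     : HPrec → Formula k m → Formula k m → Formula k m

eqB : Bool → Bool → Bool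
eqB true true = true
eqB false false = true
eqB _ _ = false

eqFin : ∀ {n} → Fin n → Fin n → Bool
eqFin i j = ⌊ i F.≟ j ⌋

eqAtom : ∀ {k m} → Fin k ⊎ Fin m → Fin k ⊎ Fin m → Bool
eqAtom (Data.Sum.inj₁ a) (Data.Sum.inj₁ b) = eqFin a b
eqAtom (Data.Sum.inj₂ a) (Data.Sum.inj₂ b) = eqFin a b
eqAtom _ _ = false

eqΠ : PrecSet → PrecSet → Bool
eqΠ (precSet a b c _) (precSet a' b' c' _) = eqB a a' ∧ eqB b b' ∧ eqB c c'

eqH : HPrec → HPrec → Bool
eqH yieldH yieldH = true
eqH takeH takeH = true
eqH _ _ = false

eqF : ∀ {k m} → Formula k m → Formula k m → Bool
eqF (atom a) (atom b) = eqAtom a b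
eqF (¬F f) (¬F g) = eqF f g
eqF (f ∨F f') (g ∨F g') = eqF f g ∧ eqF f' g'
eqF (nextΠ p f) (nextΠ q g) = eqΠ p q ∧ eqF f g
eqF (backΠ p f) (backΠ q g) = eqΠ p q ∧ eqF f g
eqF (χF p f) (χF q g) = eqΠ p q ∧ eqF f g
eqF (χP p f) (χP q g) = eqΠ p q ∧ eqF f g
eqF (Uχ p f f') (Uχ q g g') = eqΠ p q ∧ eqF f g ∧ eqF f' g'
eqF (Sχ p f f') (Sχ q g g') = eqΠ p q ∧ eqF f g ∧ eqF f' g'
eqF (nextH p f) (nextH q g) = eqH p q ∧ eqF f g
eqF (backH p f) (backH q g) = eqH p q ∧ eqF f g
eqF (UH p f f') (UH q g g') = eqH p q ∧ eqF f g ∧ eqF f' g'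
eqF (SH p f f') (SH q g g') = eqH p q ∧ eqF f g ∧ eqF f' g'
eqF _ _ = false

subformulas : ∀ {k m} → Formula k m → List (Formula k m)
subformulas f@(atom _) = f ∷ []
subformulas f@(¬F g) = f ∷ subformulas g
subformulas f@(g ∨F h) = f ∷ subformulas g ++ subformulas h
subformulas f@(nextΠ _ g) = f ∷ subformulas g
subformulas f@(backΠ _ g) = f ∷ subformulas g
subformulas f@(χF _ g) = f ∷ subformulas g
subformulas f@(χP _ g) = f ∷ subformulas g
subformulas f@(Uχ _ g h) = f ∷ subformulas g ++ subformulas h
subformulas f@(Sχ _ g h) = f ∷ subformulas g ++ subformulas h
subformulas f@(nextH _ g) = f ∷ subformulas g
subformulas f@(backH _ g) = f ∷ subformulas g
subformulas f@(UH _ g h) = f ∷ subformulas g ++ subformulas h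
subformulas f@(SH _ g h) = f ∷ subformulas g ++ subformulas h

isHierarchical : ∀ {k m} → Formula k m → Bool
isHierarchical (nextH _ _) = true
isHierarchical (backH _ _) = true
isHierarchical (UH _ _ _) = true
isHierarchical (SH _ _ _) = true
isHierarchical _ = false

numHier : ∀ {k m} → Formula k m → ℕ
numHier φ = length (deduplicateᵇ eqF (filterᵇ isHierarchical (subformulas φ)))

-- symbol at position i of  # P(1) ... P(n) #, relative to P(1)...P(n);
-- nothing = not a position of the word
atV : ∀ {k m n} → Vec (Letter k m) n → ℕ → Maybe (Sym k m)
atV [] zero = just hash
atV [] (suc _) = nothing
atV (x ∷ xs) zero = just (sym x)
atV (x ∷ xs) (suc i) = atV xs i

precPos : ∀ {k m} → Mat m → Maybe (Sym k m) → Maybe (Sym k m) → Maybe Prec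
precPos M (just a) (just b) = precS M a b
precPos M _ _ = nothing

data UPath (N : ℕ → Set) (S : ℕ → ℕ → Set) (P Q : ℕ → Set) (b : ℕ) : ℕ → Set where
  uend  : N b → Q b → UPath N S P Q b b
  ucons : ∀ {a a'} → N a → P a → a < a' → S a a' → UPath N S P Q b a' → UPath N S P Q b a

data SPath (N : ℕ → Set) (S : ℕ → ℕ → Set) (P Q : ℕ → Set) (a : ℕ) : ℕ → Set where
  sstart : N a → Q a → SPath N S P Q a a
  ssnoc  : ∀ {b' b} → SPath N S P Q a b' → b' < b → S b' b → N b → P b → SPath N S P Q a b

module Semantics {k m : ℕ} (M : Mat m) {n : ℕ} (w : Vec (Letter k m) n) where

  -- position 0 is #, positions 1..n are the letters, n+1 is #
  at : ℕ → Maybe (Sym k m)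
  at zero = just hash
  at (suc i) = atV w i

  Rel : ℕ → Prec → ℕ → Set
  Rel i π j = precPos M (at i) (at j) ≡ just π

  RelΠ : ℕ → PrecSet → ℕ → Set
  RelΠ i Π j = Σ Prec λ π → π ∈P Π × Rel i π j

  data Chain : ℕ → ℕ → Set
  data Link : ℕ → ℕ → Set
  data EqSeq : ℕ → ℕ → Set

  -- consecutive c_t, c_{t+1}: either adjacent (s_t empty) or c_t s_t c_{t+1} chain
  data Link where
    adjacent : ∀ {i} → Link i (suc i)
    nested   : ∀ {i j} → Chain i j → Link i j

  data EqSeq where
    eqOne  : ∀ {p} → EqSeq p p
    eqMore : ∀ {p q r} → Link p q → Rel p ≐ q → EqSeq q r → EqSeq p r

  data Chain where
    chain : ∀ {i p q j} → Link i p → Rel i ⋖ p → EqSeq p q → Link q j → Rel q ⋗ j → Chain i j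

  χ : ℕ → ℕ → Set
  χ i j = suc i < j × Chain i j

  InWord : ℕ → Set
  InWord i = i ≤ suc n

  -- summary-path step for Π, relative to the path endpoint b
  K : PrecSet → ℕ → ℕ → ℕ → Set
  K Π b a h = h ≤ b × χ a h × RelΠ a Π h

  SumStep : PrecSet → ℕ → ℕ → ℕ → Set
  SumStep Π b a a' =
      (K Π b a a' × (∀ h → K Π b a h → h ≤ a'))
    ⊎ ((∀ h → ¬ K Π b a h) × a' ≡ suc a × RelΠ a Π a')

  HNode : HPrec → ℕ → ℕ → Set
  HNode yieldH h a = InWord a × χ h a × Rel h ⋖ a
  HNode takeH  h a = InWord a × χ a h × Rel a ⋗ h

  HStep : HPrec → ℕ → ℕ → ℕ → Set
  HStep yieldH h a a' = ∀ k → a < k → k < a' → ¬ χ h k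
  HStep takeH  h a a' = ∀ k → a < k → k < a' → ¬ χ k h

  HSet : HPrec → ℕ → ℕ → Set
  HSet yieldH h k = χ h k × Rel h ⋖ k
  HSet takeH  h k = χ k h × Rel k ⋗ h

  HAnchor : HPrec → ℕ → ℕ → Set
  HAnchor yieldH i h = χ h i × Rel h ⋖ i
  HAnchor takeH  i h = χ i h × Rel i ⋗ h

  Sat : Formula k m → ℕ → Set
  Sat (atom (Data.Sum.inj₁ a)) i with at i
  ... | just (sym (N , _)) = T (Data.Vec.lookup N a)
  ... | _ = ⊥
  Sat (atom (Data.Sum.inj₂ a)) i with at i
  ... | just (sym (_ , S)) = T (Data.Vec.lookup S a)
  ... | _ = ⊥
  Sat (¬F φ) i = ¬ Sat φ i
  Sat (φ ∨F ψ) i = Sat φ i ⊎ Sat ψ i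
  Sat (nextΠ Π φ) i = RelΠ i Π (suc i) × Sat φ (suc i)
  Sat (backΠ Π φ) zero = ⊥
  Sat (backΠ Π φ) (suc i) = RelΠ i Π (suc i) × Sat φ i
  Sat (χF Π φ) i = Σ ℕ λ j → i < j × χ i j × RelΠ i Π j × Sat φ j
  Sat (χP Π φ) i = Σ ℕ λ j → j < i × χ j i × RelΠ j Π i × Sat φ j
  Sat (Uχ Π φ ψ) i = Σ ℕ λ j → i ≤ j ×
    UPath InWord (SumStep Π j) (Sat φ) (Sat ψ) j i
  Sat (Sχ Π φ ψ) i = Σ ℕ λ j → j ≤ i ×
    SPath InWord (SumStep Π i) (Sat φ) (Sat ψ) j i
  Sat (nextH μ φ) i = Σ ℕ λ h → HAnchor μ i h × Σ ℕ λ k → i < k × HSet μ h k ×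
    (∀ k' → i < k' → HSet μ h k' → k ≤ k') × Sat φ k
  Sat (backH μ φ) i = Σ ℕ λ h → HAnchor μ i h × Σ ℕ λ k → k < i × HSet μ h k ×
    (∀ k' → k' < i → HSet μ h k' → k' ≤ k) × Sat φ k
  Sat (UH μ φ ψ) i = Σ ℕ λ j → i ≤ j × Σ ℕ λ h →
    UPath (HNode μ h) (HStep μ h) (Sat φ) (Sat ψ) j i
  Sat (SH μ φ ψ) i = Σ ℕ λ j → j ≤ i × Σ ℕ λ h →
    SPath (HNode μ h) (HStep μ h) (Sat φ) (Sat ψ) j i

  CtxDefined : ℕ → ℕ → Set
  CtxDefined i j = Is-just (precPos M (at i) (at j))
                 ⊎ (at i ≡ just hash × at j ≡ just hash)

  Compatible : Set
  Compatible =
      (∀ i → 1 ≤ i → suc i ≤ n → Is-just (precPos M (at i) (at (suc i))))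
    × (∀ i j → Chain i j → CtxDefined i j)

record OPA (k m : ℕ) : Set where
  field
    nQ    : ℕ
    init  : Fin nQ → Bool
    final : Fin nQ → Bool
    δpush  : Fin nQ → Letter k m → Fin nQ → Bool
    δshift : Fin nQ → Letter k m → Fin nQ → Bool
    δpop   : Fin nQ → Fin nQ → Fin nQ → Bool

module Run {k m : ℕ} (M : Mat m) (A : OPA k m) where
  open OPA A

  Stack : Set
  Stack = List (Letter k m × Fin nQ)

  -- configuration ⟨x #, q, γ⟩ (the trailing # of the input and ⊥ are implicit)
  record Config : Set where
    constructor ⟨_,_,_⟩
    field
      input : List (Letter k m)
      state : Fin nQ
      stack : Stack

  top : Stack → Sym k m
  top [] = hash
  top ((a , _) ∷ _) = sym a

  next : List (Letter k m) → Sym k m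
  next [] = hash
  next (b ∷ _) = sym b

  data Step : Config → Config → Set where
    push  : ∀ {b x p q γ} → precS M (top γ) (sym b) ≡ just ⋖ → T (δpush p b q) →
            Step ⟨ b ∷ x , p , γ ⟩ ⟨ x , q , (b , p) ∷ γ ⟩
    shift : ∀ {a b x p q r γ} → precL M a b ≡ just ≐ → T (δshift q b r) →
            Step ⟨ b ∷ x , q , (a , p) ∷ γ ⟩ ⟨ x , r , (b , p) ∷ γ ⟩
    pop   : ∀ {a x p q r γ} → precS M (sym a) (next x) ≡ just ⋗ → T (δpop q p r) →
            Step ⟨ x , q , (a , p) ∷ γ ⟩ ⟨ x , r , γ ⟩

  data Steps : Config → Config → Set where
    done : ∀ {c} → Steps c c
    more : ∀ {c d e} → Step c d → Steps d e → Steps c e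

  Accepts : List (Letter k m) → Set
  Accepts x = Σ (Fin nQ) λ qI → Σ (Fin nQ) λ qF →
    T (init qI) × T (final qF) × Steps ⟨ x , qI , [] ⟩ ⟨ [] , qF , [] ⟩

-- letters of 2^(AP ∪ H): normal part Fin (k + h), first k are AP's normals
restrictAP : ∀ {k h m} → Letter (k + h) m → Letter k m
restrictAP {k} (N , S) = take k N , S

{-# OPTIONS --safe #-}
module Submission where

-- POTL is embedded in monadic second-order logic over OP words with the chain
-- relation, and that logic is decided by operator precedence automata. A
-- compatible word has exactly one parse, so deterministic machines, evaluated
-- along the parse, are closed under complement and product; a set quantifier is
-- a projection, determinised by letting states be relations between the state
-- saved by the last push and the current state. The until and since operators
-- become "every set of positions closed under the path step contains i", so no
-- expansion law is needed. The automaton ignores the propositions of H.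

open import Defs
open import Data.Bool using (Bool; true; false; _∧_; _∨_; not; T; if_then_else_)
open import Data.Bool.Properties using (T?; T-∧; T-∨)
open import Data.Empty using (⊥)
open import Data.Fin using (Fin; zero; suc; combine; remQuot)
import Data.Fin as F
open import Data.Fin.Properties using (any?; remQuot-combine)
open import Data.List using (List; []; _∷_)
open import Data.Maybe using (Maybe; just; nothing)
import Data.Maybe as Maybe
open import Data.Nat using (ℕ; zero; suc; _+_; _*_; _∸_; _≤_; _<_; z≤n; s≤s; _≡ᵇ_)
open import Data.Nat.Properties
open import Data.Product using (Σ; ∃; _×_; _,_; proj₁; proj₂)
open import Data.Product.Function.NonDependent.Propositional using (_×-⇔_)
open import Data.Sum using (_⊎_; inj₁; inj₂)
open import Data.Sum.Function.Propositional using (_⊎-⇔_)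
open import Data.Unit using (tt)
open import Data.Vec using (Vec; []; _∷_; _++_; map; toList; lookup; tabulate; replicate; take)
open import Data.Vec.Properties using (lookup∘tabulate; lookup-map)
open import Data.Vec.Relation.Unary.All using (All; []; _∷_)
open import Data.Vec.Relation.Unary.All.Properties using (lookup⁺)
open import Function.Base using (_∘_; id)
open import Function.Bundles using (_⇔_; mk⇔; Equivalence)
import Function.Properties.Equivalence as ⇔
open import Function.Related.TypeIsomorphisms using (→-cong-⇔; ¬-cong-⇔)
open import Relation.Binary.Construct.Closure.ReflexiveTransitive using (Star; ε; _◅_; _◅◅_)
open import Relation.Binary.Definitions using (tri<; tri≈; tri>)
open import Relation.Binary.PropositionalEquality using (_≡_; refl; cong; cong₂; trans; subst; subst₂) renaming (sym to ≡-sym)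
open import Relation.Nullary using (¬_; Dec; yes; no; contradiction)
open import Relation.Nullary.Decidable using (⌊_⌋; map′; toWitness; fromWitness; _×-dec_; decidable-stable)

open Equivalence using (to; from)

-- The argument is constructive, and this shapes the logic. Set variables range over Boolean
-- functions, the only sets that a machine can guess; to extract a path from "every closed set
-- contains i", the set of positions that have a path must therefore be given as a Boolean function.
-- Its decidability comes from the compiled machines: acceptance along the parse is a Boolean
-- equivalent to the truth of the formula. The same fact removes the double negations left by
-- universal quantifiers. Projection works because the matrix alone fixes the parse, so added tracks
-- never change a stack move. A state of the projection cannot be a plain set of current states: at
-- a pop, it must still be known which saved state belongs to which current state, since both depend
-- on the guesses made before the push. Chains and paths may touch the end markers, so quantified
-- positions include 0 and n + 1.

private variable
  A B L L' : Set

-- Finite types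

-- `dec-enc` makes `enc` injective, so equality on `A` is decided on codes, and it lets a search for
-- an element of `A` run over all codes.
record Finite (A : Set) : Set where
  field
    size    : ℕ
    enc     : A → Fin size
    dec     : Fin size → A
    dec-enc : ∀ x → dec (enc x) ≡ x

open Finite

retract : Finite A → (f : B → A) (g : A → B) → (∀ y → g (f y) ≡ y) → Finite B
retract F f g gf = record
  { size = size F ; enc = enc F ∘ f ; dec = g ∘ dec F
  ; dec-enc = λ y → trans (cong g (dec-enc F (f y))) (gf y) }

boolFinite : Finite Bool
boolFinite = record
  { size = 2
  ; enc = λ { false → zero ; true → suc zero }
  ; dec = λ { zero → false ; (suc _) → true }
  ; dec-enc = λ { false → refl ; true → refl } }

×-finite : Finite A → Finite B → Finite (A × B)
×-finite F G = record
  { size = size F * size G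
  ; enc = λ (x , y) → combine (enc F x) (enc G y)
  ; dec = λ i → dec F (proj₁ (remQuot {size F} (size G) i)) , dec G (proj₂ (remQuot {size F} (size G) i))
  ; dec-enc = λ (x , y) →
      trans (cong (λ (i , j) → dec F i , dec G j) (remQuot-combine (enc F x) (enc G y)))
            (cong₂ _,_ (dec-enc F x) (dec-enc G y)) }

maybeFinite : Finite A → Finite (Maybe A)
maybeFinite F = record
  { size = suc (size F)
  ; enc = λ { nothing → zero ; (just x) → suc (enc F x) }
  ; dec = λ { zero → nothing ; (suc i) → just (dec F i) }
  ; dec-enc = λ { nothing → refl ; (just x) → cong just (dec-enc F x) } }

vecFinite : Finite A → ∀ n → Finite (Vec A n)
vecFinite F zero = record
  { size = 1 ; enc = λ _ → zero ; dec = λ _ → [] ; dec-enc = λ { [] → refl } }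
vecFinite F (suc n) =
  retract (×-finite F (vecFinite F n)) (λ { (x ∷ xs) → x , xs }) (λ (x , xs) → x ∷ xs)
          (λ { (x ∷ xs) → refl })

symFinite : ∀ k m → Finite (Sym k m)
symFinite k m =
  retract (maybeFinite (×-finite (vecFinite boolFinite k) (vecFinite boolFinite m)))
          (λ { hash → nothing ; (sym a) → just a })
          (λ { nothing → hash ; (just a) → sym a })
          (λ { hash → refl ; (sym a) → refl })

module _ (F : Finite A) where

  ≡-dec : (x y : A) → Dec (x ≡ y)
  ≡-dec x y =
    map′ (λ e → trans (≡-sym (dec-enc F x)) (trans (cong (dec F) e) (dec-enc F y)))
         (cong (enc F)) (enc F x F.≟ enc F y)

  ∃-dec : {P : A → Set} → (∀ x → Dec (P x)) → Dec (∃ P)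
  ∃-dec {P} P? =
    map′ (λ (i , p) → dec F i , p)
         (λ (x , p) → enc F x , subst P (≡-sym (dec-enc F x)) p)
         (any? (P? ∘ dec F))

  -- A Boolean matrix instead of a function into `Bool`: `dec-enc` asks for propositional equality,
  -- which for functions would require extensionality.
  RelCode : Set
  RelCode = Vec (Vec Bool (size F)) (size F)

  relCodeFinite : Finite RelCode
  relCodeFinite = vecFinite (vecFinite boolFinite (size F)) (size F)

  Holds : RelCode → A → A → Set
  Holds R x y = T (lookup (lookup R (enc F x)) (enc F y))

  abstract
    encode : {R : A → A → Set} → (∀ x y → Dec (R x y)) → RelCode
    encode R? = tabulate λ i → tabulate λ j → ⌊ R? (dec F i) (dec F j) ⌋

    Holds-encode : {R : A → A → Set} (R? : ∀ x y → Dec (R x y)) →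
                   ∀ {x y} → Holds (encode R?) x y ⇔ R x y
    Holds-encode R? {x} {y} =
      mk⇔ (λ h → toWitness (subst T eq h)) (λ r → subst T (≡-sym eq) (fromWitness r))
      where
      eq : lookup (lookup (encode R?) (enc F x)) (enc F y) ≡ ⌊ R? x y ⌋
      eq = trans (cong (λ v → lookup v (enc F y)) (lookup∘tabulate _ (enc F x)))
          (trans (lookup∘tabulate _ (enc F y))
                 (cong₂ (λ a b → ⌊ R? a b ⌋) (dec-enc F x) (dec-enc F y)))

-- Deterministic operator precedence machines

-- The labels at positions 0 and n + 1 (the two end markers) are read by ini and fin.
record Mach (L : Set) : Set₁ where
  field
    Q      : Set
    finite : Finite Q
    ini    : L → Q
    push   : Q → L → Q
    shift  : Q → L → Q
    pop    : Q → Q → Q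
    fin    : Q → L → Bool

product : (Bool → Bool → Bool) → Mach L → Mach L → Mach L
product op A B = record
  { Q = Q A × Q B
  ; finite = ×-finite (finite A) (finite B)
  ; ini = λ l → ini A l , ini B l
  ; push = λ (p , q) l → push A p l , push B q l
  ; shift = λ (p , q) l → shift A p l , shift B q l
  ; pop = λ (p , q) (p' , q') → pop A p p' , pop B q q'
  ; fin = λ (p , q) l → op (fin A p l) (fin B q l) }
  where open Mach

-- Subset construction: a state of the projection relates the state saved by
-- the last push to the current state.
project : (Bool → L → L') → Mach L' → Mach L
project ins A = record
  { Q = RelCode finite
  ; finite = relCodeFinite finite
  ; ini = λ l → encode finite λ _ q →
      ∃-dec boolFinite λ b → ≡-dec finite q (ini (ins b l))
  ; push = λ _ l → encode finite λ p q →
      ∃-dec boolFinite λ b → ≡-dec finite q (push p (ins b l))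
  ; shift = λ R l → encode finite λ p q → ∃-dec finite λ q₀ →
      holds? R p q₀ ×-dec ∃-dec boolFinite λ b → ≡-dec finite q (shift q₀ (ins b l))
  -- `R'` is the current relation and `R` the saved one. A push starts the new level from every
  -- possible saved state `p`; here the rows of `R'` are matched with the columns of `R`, which ties
  -- the inner run to the outer run it started from.
  ; pop = λ R' R → encode finite λ s r → ∃-dec finite λ p →
      holds? R s p ×-dec ∃-dec finite λ q →
      holds? R' p q ×-dec ≡-dec finite r (pop q p)
  ; fin = λ R l → ⌊ ∃-dec finite (λ p → ∃-dec finite λ q →
      holds? R p q ×-dec ∃-dec boolFinite λ b → T? (fin q (ins b l))) ⌋ }
  where
  open Mach A
  holds? : ∀ R p q → Dec (Holds finite R p q)
  holds? R p q = T? _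

-- An ordinary finite automaton: a pop hands on the current state and drops the saved one, so the
-- state depends only on the positions read so far.
linear : {Q : Set} → Finite Q → Q → (Q → L → Q) → (Q → Bool) → Mach L
linear {Q = Q} F q₀ step acc = record
  { Q = Q ; finite = F ; ini = step q₀ ; push = step ; shift = step
  ; pop = λ q _ → q ; fin = λ q l → acc (step q l) }

-- Glues the tracks guessed independently to the left of `p`, at `p` and to its right.
splice : ℕ → (ℕ → Bool) → Bool → (ℕ → Bool) → ℕ → Bool
splice p X b Y i with <-cmp i p
... | tri< _ _ _ = X i
... | tri≈ _ _ _ = b
... | tri> _ _ _ = Y i

splice-< : ∀ {i p} X b Y → i < p → splice p X b Y i ≡ X i
splice-< {i} {p} X b Y i<p with <-cmp i p
... | tri< _ _ _ = refl
... | tri≈ i≮p _ _ = contradiction i<p i≮p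
... | tri> i≮p _ _ = contradiction i<p i≮p

splice-≡ : ∀ p X b Y → splice p X b Y p ≡ b
splice-≡ p X b Y with <-cmp p p
... | tri< _ p≢p _ = contradiction refl p≢p
... | tri≈ _ _ _ = refl
... | tri> _ p≢p _ = contradiction refl p≢p

splice-> : ∀ {p i} X b Y → p < i → splice p X b Y i ≡ Y i
splice-> {p} {i} X b Y p<i with <-cmp i p
... | tri< _ _ i≯p = contradiction p<i i≯p
... | tri≈ _ _ i≯p = contradiction p<i i≯p
... | tri> _ _ _ = refl

-- Evaluation of machines along a parse

module Evaluation {k m : ℕ} (M : Mat m) {n : ℕ} (w : Vec (Letter k m) n) where
  open Semantics M w

  private variable
    a h i j p q x y : ℕ

  -- Parse a h j: what the machine has done at one stack level between reading
  -- position a there and a moment when h is on top and j is the next input.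
  data Parse : ℕ → ℕ → ℕ → Set where
    nil   : Parse a a (suc a)
    shift : Parse a h j → Rel h ≐ j → Parse a j (suc j)
    node  : Parse a h p → Rel h ⋖ p → Parse p q j → Rel q ⋗ j → Parse a h j

  mutual
    top<next : Parse a h j → h < j
    top<next nil = ≤-refl
    top<next (shift t _) = ≤-refl
    top<next (node t _ t' _) = <-trans (top<next t) (start<next t')

    start≤top : Parse a h j → a ≤ h
    start≤top nil = ≤-refl
    start≤top (shift t _) = <⇒≤ (start<next t)
    start≤top (node t _ _ _) = start≤top t

    start<next : Parse a h j → a < j
    start<next t = ≤-<-trans (start≤top t) (top<next t)

  -- `s` is the state just after `a` was read, so only labels strictly between `a` and `j` are
  -- consulted.
  eval : (A : Mach L) → (ℕ → L) → Mach.Q A → Parse a h j → Mach.Q A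
  eval A lab s nil = s
  eval A lab s (shift {j = j} t _) = Mach.shift A (eval A lab s t) (lab j)
  eval A lab s (node {p = p} t _ t' _) =
    Mach.pop A (eval A lab (Mach.push A (eval A lab s t) (lab p)) t') (eval A lab s t)

  opaque
    accept : (A : Mach L) → (ℕ → L) → Parse 0 0 (suc n) → Bool
    accept A lab t = Mach.fin A (eval A lab (Mach.ini A (lab 0)) t) (lab (suc n))

  opaque
    unfolding accept

    accept-≡ : (A : Mach L) (lab : ℕ → L) (t : Parse 0 0 (suc n)) →
      accept A lab t ≡ Mach.fin A (eval A lab (Mach.ini A (lab 0)) t) (lab (suc n))
    accept-≡ A lab t = refl

  eval-cong : (A : Mach L) {lab lab' : ℕ → L} (t : Parse a h j) →
              (∀ i → a < i → i < j → lab i ≡ lab' i) →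
              ∀ s → eval A lab s t ≡ eval A lab' s t
  eval-cong A nil e s = refl
  eval-cong A (shift t _) e s =
    cong₂ (Mach.shift A) (eval-cong A t (λ i l g → e i l (m<n⇒m<1+n g)) s)
                         (e _ (start<next t) ≤-refl)
  eval-cong A {lab} {lab'} (node {p = p} t _ t' _) e s =
    cong₂ (Mach.pop A)
      (trans (eval-cong A t' (λ i l g → e i (<-trans (start<next t) l) g) _)
             (cong (λ r → eval A lab' r t') (cong₂ (Mach.push A) eq (e p (start<next t) (start<next t')))))
      eq
    where eq = eval-cong A {lab} {lab'} t (λ i l g → e i l (<-trans g (start<next t'))) s

  opaque
    unfolding accept
    accept-cong : (A : Mach L) {lab lab' : ℕ → L} (t : Parse 0 0 (suc n)) →
                  (∀ i → i ≤ suc n → lab i ≡ lab' i) → accept A lab t ≡ accept A lab' t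
    accept-cong A {lab' = lab'} t e =
      cong₂ (Mach.fin A)
        (trans (eval-cong A t (λ i _ g → e i (<⇒≤ g)) _)
               (cong (λ l → eval A lab' (Mach.ini A l) t) (e 0 z≤n)))
        (e (suc n) ≤-refl)

  eval-product : (op : Bool → Bool → Bool) (A B : Mach L) (lab : ℕ → L) (t : Parse a h j) →
                 ∀ r s → eval (product op A B) lab (r , s) t ≡ (eval A lab r t , eval B lab s t)
  eval-product op A B lab nil r s = refl
  eval-product op A B lab (shift t _) r s rewrite eval-product op A B lab t r s = refl
  eval-product op A B lab (node {p = p} t _ t' _) r s
    rewrite eval-product op A B lab t r s
          | eval-product op A B lab t' (Mach.push A (eval A lab r t) (lab p))
                                       (Mach.push B (eval B lab s t) (lab p)) = refl

  opaque
    unfolding accept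
    accept-product : (op : Bool → Bool → Bool) (A B : Mach L) (lab : ℕ → L) (t : Parse 0 0 (suc n)) →
                     accept (product op A B) lab t ≡ op (accept A lab t) (accept B lab t)
    accept-product op A B lab t
      rewrite eval-product op A B lab t (Mach.ini A (lab 0)) (Mach.ini B (lab 0)) = refl

  module _ (ins : Bool → L → L') (A : Mach L') (lab : ℕ → L) where
    private
      module A = Mach A
      module P = Mach (project ins A)

    withTrack : (ℕ → Bool) → ℕ → L'
    withTrack X i = ins (X i) (lab i)

    private
      ins-≡ : ∀ i {b c} → b ≡ c → ins b (lab i) ≡ ins c (lab i)
      ins-≡ i = cong (λ b → ins b (lab i))

    project-complete : ∀ X (t : Parse a h j) {R s r} → Holds A.finite R s r →
      Holds A.finite (eval (project ins A) lab R t) s (eval A (withTrack X) r t)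
    project-complete X nil H = H
    project-complete X (shift {j = j} t _) H =
      from (Holds-encode A.finite _) (_ , project-complete X t H , X j , refl)
    project-complete X (node {p = p} t _ t' _) H =
      from (Holds-encode A.finite _)
        (_ , project-complete X t H
        , _ , project-complete X t' (from (Holds-encode A.finite _) (X p , refl)) , refl)

    -- At a `node` the two recursive tracks may disagree, but the outer parse looks only at
    -- positions before `p`, the inner one only at positions after it, and the bit at `p` is guessed
    -- by the push; hence they can be spliced.
    project-sound : (t : Parse a h j) → ∀ {R s r} →
      Holds A.finite (eval (project ins A) lab R t) s r →
      ∃ λ q → Holds A.finite R s q × ∃ λ X → r ≡ eval A (withTrack X) q t
    project-sound nil H = _ , H , (λ _ → false) , refl
    project-sound (shift {j = j} t _) H
      with to (Holds-encode A.finite _) H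
    ... | q₁ , H₁ , b , refl with project-sound t H₁
    ... | q , H₀ , X , refl =
      q , H₀ , splice j X b X ,
      cong₂ A.shift
        (eval-cong A t (λ i _ g → ins-≡ i (≡-sym (splice-< X b X g))) q)
        (ins-≡ j (≡-sym (splice-≡ j X b X)))
    project-sound (node {p = p} t _ t' _) H
      with to (Holds-encode A.finite _) H
    ... | q₁ , H₁ , q₂ , H₂ , refl with project-sound t H₁ | project-sound t' H₂
    ... | q , H₀ , X , refl | q₃ , H₃ , Y , refl with to (Holds-encode A.finite _) H₃
    ... | b , refl =
      q , H₀ , splice p X b Y ,
      cong₂ A.pop
        (trans (eval-cong A t' (λ i l _ → ins-≡ i (≡-sym (splice-> X b Y l))) _)
               (cong (λ s → eval A (withTrack (splice p X b Y)) s t')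
                     (cong₂ A.push eq (ins-≡ p (≡-sym (splice-≡ p X b Y))))))
        eq
      where
      eq : eval A (withTrack X) q t ≡ eval A (withTrack (splice p X b Y)) q t
      eq = eval-cong A t (λ i _ g → ins-≡ i (≡-sym (splice-< X b Y g))) q

    opaque
      unfolding accept
      accept-project : (t : Parse 0 0 (suc n)) →
        T (accept (project ins A) lab t) ⇔ ∃ λ X → T (accept A (withTrack X) t)
      accept-project t = mk⇔ sound complete
        where
        sound : T (accept (project ins A) lab t) → ∃ λ X → T (accept A (withTrack X) t)
        sound acc with toWitness acc
        ... | _ , r , H , c , final with project-sound t H
        ... | q , H₀ , X , refl with to (Holds-encode A.finite _) H₀
        ... | b , refl = Z , subst T (cong₂ A.fin
            (trans (eval-cong A t (λ i l g → ins-≡ i (≡-sym (inner i l g))) _)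
                   (cong (λ d → eval A (withTrack Z) (A.ini (ins d (lab 0))) t)
                         (≡-sym (trans (splice-< {0} {suc n} Y c Y (s≤s z≤n)) (splice-≡ 0 X b X)))))
            (ins-≡ (suc n) (≡-sym (splice-≡ (suc n) Y c Y)))) final
          where
          Y Z : ℕ → Bool
          -- The parse constrains `X` only strictly between the end markers; the bits guessed by
          -- `ini` and `fin` are put in at 0 and `suc n`.
          Y = splice 0 X b X
          Z = splice (suc n) Y c Y
          inner : ∀ i → 0 < i → i < suc n → Z i ≡ X i
          inner i l g = trans (splice-< Y c Y g) (splice-> X b X l)
        complete : (∃ λ X → T (accept A (withTrack X) t)) → T (accept (project ins A) lab t)
        complete (X , acc) = fromWitness
          (A.ini (withTrack X 0) , _
          , project-complete X t (from (Holds-encode A.finite _) (X 0 , refl))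
          , X (suc n) , acc)

  module _ {Q : Set} (F : Finite Q) (q₀ : Q) (step : Q → L → Q) (acc : Q → Bool) (lab : ℕ → L)
           (Inv : ℕ → Q → Set)
           (Inv-step : ∀ {j q} → j ≤ suc n → Inv j q → Inv (suc j) (step q (lab j))) where

    private
      eval-linear : (t : Parse a h j) → j ≤ suc n → ∀ {s} → Inv (suc a) s →
                    Inv j (eval (linear F q₀ step acc) lab s t)
      eval-linear nil _ v = v
      eval-linear (shift t _) b v = Inv-step (<⇒≤ b) (eval-linear t (<⇒≤ b) v)
      eval-linear (node t _ t' _) b v =
        eval-linear t' b (Inv-step p≤ (eval-linear t p≤ v))
        where p≤ = ≤-trans (<⇒≤ (start<next t')) b

    opaque
      unfolding accept
      accept-linear : Inv 0 q₀ → (t : Parse 0 0 (suc n)) →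
        ∃ λ q → Inv (suc (suc n)) q × accept (linear F q₀ step acc) lab t ≡ acc q
      accept-linear v t = _ , Inv-step ≤-refl (eval-linear t ≤-refl (Inv-step z≤n v)) , refl

-- Maximal runs and the symbols of a word

just-unique : {z : Maybe A} {c d : A} → z ≡ just c → z ≡ just d → c ≡ d
just-unique refl refl = refl

-- Serves twice: for the uniqueness of the parse and for the runs of the final automaton.
deterministic-end : {C : Set} {R : C → C → Set} → (∀ {c d e} → R c d → R c e → d ≡ e) →
                    ∀ {c d e} → Star R c d → (∀ {z} → ¬ R d z) →
                    Star R c e → (∀ {z} → ¬ R e z) → d ≡ e
deterministic-end det ε stop ε stop' = refl
deterministic-end det ε stop (r ◅ _) stop' = contradiction r stop
deterministic-end det (r ◅ _) stop ε stop' = contradiction r stop'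
deterministic-end {R = R} det (r ◅ rs) stop (r' ◅ rs') stop' with det r r'
... | refl = deterministic-end {R = R} det rs stop rs' stop'

module _ {k m : ℕ} where

  atV-bound : ∀ {n} (w : Vec (Letter k m) n) {i c} → atV w i ≡ just c → i ≤ n
  atV-bound [] {zero} _ = z≤n
  atV-bound (_ ∷ w) {zero} _ = z≤n
  atV-bound (_ ∷ w) {suc i} e = s≤s (atV-bound w e)

  atV-letter : ∀ {n} (w : Vec (Letter k m) n) {i b} → atV w i ≡ just (sym b) → i < n
  atV-letter (_ ∷ w) {zero} _ = s≤s z≤n
  atV-letter (_ ∷ w) {suc i} e = s≤s (atV-letter w e)

  atV-hash : ∀ {n} (w : Vec (Letter k m) n) {i} → atV w i ≡ just hash → i ≡ n
  atV-hash [] {zero} _ = refl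
  atV-hash (_ ∷ w) {suc i} e = cong suc (atV-hash w e)

  atV-end : ∀ {n} (w : Vec (Letter k m) n) → atV w n ≡ just hash
  atV-end [] = refl
  atV-end (_ ∷ w) = atV-end w

  atV-inside : ∀ {n} (w : Vec (Letter k m) n) {i} → i < n → ∃ λ b → atV w i ≡ just (sym b)
  atV-inside (b ∷ w) {zero} _ = b , refl
  atV-inside (_ ∷ w) {suc i} (s≤s l) = atV-inside w l

-- Chains and parses

module Parsing {k m : ℕ} (M : Mat m) {n : ℕ} (w : Vec (Letter k m) n) where
  open Semantics M w
  open Evaluation M w

  private variable
    a e h i j p q x y : ℕ
    π : Prec

  Rel-bound : ∀ i j → Rel i π j → j ≤ suc n
  Rel-bound i zero r = z≤n
  Rel-bound i (suc j) r with at i | atV w j in eq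
  ... | just _ | just _ = s≤s (atV-bound w eq)

  ⋖-letter : Rel i ⋖ j → ∃ λ b → at j ≡ just (sym b)
  ⋖-letter {i} {j} r with at i | at j
  ... | just hash | just (sym b) = b , refl
  ... | just (sym _) | just (sym b) = b , refl

  ≐-letters : Rel i ≐ j → ∃ λ b → ∃ λ c → at i ≡ just (sym b) × at j ≡ just (sym c)
  ≐-letters {i} {j} r with at i | at j | r
  ... | just (sym b) | just (sym c) | _ = b , c , refl , refl
  ... | just (sym _) | just hash | ()
  ... | just hash | just (sym _) | ()
  ... | just hash | just hash | ()

  ⋗-letter : Rel i ⋗ j → ∃ λ b → at i ≡ just (sym b)
  ⋗-letter {i} {j} r with at i | at j | r
  ... | just (sym b) | just _ | _ = b , refl
  ... | just hash | just (sym _) | ()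
  ... | just hash | just hash | ()

  letter-bound : ∀ {b} → at i ≡ just (sym b) → i ≤ n
  letter-bound {suc i} e = atV-letter w e

  -- A parse grows at its right end, so links and chains are absorbed into an accumulator: a parse
  -- that has just read the left endpoint.
  Link⇒Parse : Link h j → Parse a h (suc h) → Parse a h j
  EqSeq⇒Parse : EqSeq p q → Parse a p (suc p) → Parse a q (suc q)
  Chain⇒Parse : Chain h j → Parse a h (suc h) → Parse a h j
  Link⇒Parse adjacent t = t
  Link⇒Parse (nested c) t = Chain⇒Parse c t
  EqSeq⇒Parse eqOne t = t
  EqSeq⇒Parse (eqMore l r e) t = EqSeq⇒Parse e (shift (Link⇒Parse l t) r)
  Chain⇒Parse (chain l r e l' r') t =
    node (Link⇒Parse l t) r (Link⇒Parse l' (EqSeq⇒Parse e nil)) r'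

  EqSeq-snoc : EqSeq a h → Link h j → Rel h ≐ j → EqSeq a j
  EqSeq-snoc eqOne l r = eqMore l r eqOne
  EqSeq-snoc (eqMore l' r' e) l r = eqMore l' r' (EqSeq-snoc e l r)

  Parse⇒Link : Parse a h j → Link h j
  Parse⇒EqSeq : Parse a h j → EqSeq a h
  Parse⇒Link nil = adjacent
  Parse⇒Link (shift _ _) = adjacent
  Parse⇒Link (node t r t' r') = nested (chain (Parse⇒Link t) r (Parse⇒EqSeq t') (Parse⇒Link t') r')
  Parse⇒EqSeq nil = eqOne
  Parse⇒EqSeq (shift t r) = EqSeq-snoc (Parse⇒EqSeq t) (Parse⇒Link t) r
  Parse⇒EqSeq (node t _ _ _) = Parse⇒EqSeq t

  Link-< : Link i j → i < j
  Link-< l = top<next (Link⇒Parse l nil)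

  -- A chain has at least one inner letter, so the side condition of `χ` is automatic and the logic
  -- can use bare chains.
  Chain⇒χ : Chain i j → χ i j
  Chain⇒χ c@(chain l _ e l' _) =
    ≤-<-trans (Link-< l) (start<next (Link⇒Parse l' (EqSeq⇒Parse e nil))) , c

  Chain-bound : Chain i j → j ≤ suc n
  Chain-bound (chain {q = q} {j = j} _ _ _ _ r) = Rel-bound q j r

  -- Uniqueness of the parse

  -- The moves of an operator precedence automaton with the states erased and positions in place of
  -- letters; the matrix leaves at most one choice.
  data Move : List ℕ × ℕ → List ℕ × ℕ → Set where
    push  : ∀ {γ} → Rel h ⋖ j → Move (h ∷ γ , j) (j ∷ h ∷ γ , suc j)
    shift : ∀ {γ} → Rel h ≐ j → Move (h ∷ γ , j) (j ∷ γ , suc j)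
    pop   : ∀ {γ} → Rel h ⋗ j → Move (h ∷ γ , j) (γ , j)

  Move-deterministic : ∀ {c d e} → Move c d → Move c e → d ≡ e
  Move-deterministic (push r) (push r') = refl
  Move-deterministic (push r) (shift r') with () ← just-unique r r'
  Move-deterministic (push r) (pop r') with () ← just-unique r r'
  Move-deterministic (shift r) (push r') with () ← just-unique r r'
  Move-deterministic (shift r) (shift r') = refl
  Move-deterministic (shift r) (pop r') with () ← just-unique r r'
  Move-deterministic (pop r) (push r') with () ← just-unique r r'
  Move-deterministic (pop r) (shift r') with () ← just-unique r r'
  Move-deterministic (pop r) (pop r') = refl

  Parse⇒Moves : ∀ {γ} → Parse a h j → Star Move (a ∷ γ , suc a) (h ∷ γ , j)
  Parse⇒Moves nil = ε
  Parse⇒Moves (shift t r) = Parse⇒Moves t ◅◅ shift r ◅ ε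
  Parse⇒Moves (node t r t' r') = Parse⇒Moves t ◅◅ push r ◅ Parse⇒Moves t' ◅◅ pop r' ◅ ε

  -- With nothing below `p`, the final pop empties the stack, where no move exists. Both runs are
  -- therefore maximal and must coincide.
  pop-unique : Parse p h i → Rel h ⋗ i → Parse p q j → Rel q ⋗ j → i ≡ j
  pop-unique t r t' r' =
    cong proj₂ (deterministic-end Move-deterministic
      (Parse⇒Moves {γ = []} t ◅◅ pop r ◅ ε) (λ ())
      (Parse⇒Moves {γ = []} t' ◅◅ pop r' ◅ ε) (λ ()))

  -- The contexts of the pops performed in the parse. For the parse of the whole word they are
  -- exactly the chains, which makes the chain relation accessible to induction on the parse.
  Closes : Parse a h j → ℕ → ℕ → Set
  Closes nil x y = ⊥
  Closes (shift t _) x y = Closes t x y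
  Closes (node {h = h} {j = j} t _ t' _) x y = Closes t x y ⊎ Closes t' x y ⊎ (x ≡ h × y ≡ j)

  Closes-bound : (t : Parse a h j) → Closes t x y → y ≤ j
  Closes-bound (shift t _) c = m≤n⇒m≤1+n (Closes-bound t c)
  Closes-bound (node t _ t' _) (inj₁ c) = ≤-trans (Closes-bound t c) (<⇒≤ (start<next t'))
  Closes-bound (node t _ t' _) (inj₂ (inj₁ c)) = Closes-bound t' c
  Closes-bound (node t _ t' _) (inj₂ (inj₂ (_ , refl))) = ≤-refl

  Closes⇒Chain : (t : Parse a h j) → Closes t x y → Chain x y
  Closes⇒Chain (shift t _) c = Closes⇒Chain t c
  Closes⇒Chain (node t _ _ _) (inj₁ c) = Closes⇒Chain t c
  Closes⇒Chain (node _ _ t' _) (inj₂ (inj₁ c)) = Closes⇒Chain t' c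
  Closes⇒Chain (node t r t' r') (inj₂ (inj₂ (refl , refl))) =
    chain (Parse⇒Link t) r (Parse⇒EqSeq t') (Parse⇒Link t') r'

  -- The chunks x ⋖ p … pushed on top of x, from next input p up to next input e.
  data Chunks (Closed : ℕ → Set) (x : ℕ) : ℕ → ℕ → Set where
    []  : Chunks Closed x p p
    add : Rel x ⋖ p → Parse p q j → Rel q ⋗ j → Closed j → Chunks Closed x j e → Chunks Closed x p e

  Chunks-map : ∀ {C D : ℕ → Set} → (∀ {y} → C y → D y) → Chunks C x p e → Chunks D x p e
  Chunks-map f [] = []
  Chunks-map f (add r t r' c cs) = add r t r' (f c) (Chunks-map f cs)

  Chunks-snoc : ∀ {C : ℕ → Set} → Chunks C x i p → Rel x ⋖ p → Parse p q j → Rel q ⋗ j → C j → Chunks C x i j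
  Chunks-snoc [] r t r' c = add r t r' c []
  Chunks-snoc (add s u s' d cs) r t r' c = add s u s' d (Chunks-snoc cs r t r' c)

  -- A position leaves the top for good through a shift or a pop, that is, with `x` in relation ≐ or
  -- ⋗ to `e`; this excludes ⋖, so no further chunk can begin at `e`. The other alternative is that
  -- `x` is still on top when the parse ends.
  chunks : (t : Parse a h j) → a ≤ x → x < j →
    ∃ λ e → Chunks (Closes t x) x (suc x) e × (¬ Rel x ⋖ e ⊎ (x ≡ h × e ≡ j))
  chunks nil l g with ≤-antisym l (≤-pred g)
  ... | refl = _ , [] , inj₂ (refl , refl)
  chunks (shift t r) l g with m<1+n⇒m<n∨m≡n g
  ... | inj₂ refl = _ , [] , inj₂ (refl , refl)
  ... | inj₁ g' with chunks t l g'
  ... | e , cs , inj₁ stop = e , cs , inj₁ stop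
  ... | e , cs , inj₂ (refl , refl) = e , cs , inj₁ λ r' → contradiction (just-unique r r') λ ()
  chunks {x = x} (node {p = p} t r t' r') l g with x <? p
  ... | yes g' with chunks t l g'
  ...   | e , cs , inj₁ stop = e , Chunks-map inj₁ cs , inj₁ stop
  ...   | e , cs , inj₂ (refl , refl) =
    _ , Chunks-snoc (Chunks-map inj₁ cs) r t' r' (inj₂ (inj₂ (refl , refl))) , inj₂ (refl , refl)
  chunks (node t r t' r') l g | no x≮p with chunks t' (≮⇒≥ x≮p) g
  ...   | e , cs , inj₁ stop = e , Chunks-map (inj₂ ∘ inj₁) cs , inj₁ stop
  ...   | e , cs , inj₂ (refl , refl) =
    e , Chunks-map (inj₂ ∘ inj₁) cs , inj₁ λ r'' → contradiction (just-unique r' r'') λ ()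

  module _ {C : ℕ → Set} (stop : ¬ Rel x ⋖ e) (cs : Chunks C x (suc x) e) where
    -- A chain from `x` starts with a link to some `p` that `x` yields to. By induction `p` is a
    -- boundary in the list of chunks, and `stop` says that it is not the last one; the chunk
    -- starting there ends where the chain does, by `pop-unique`.
    Link-realised : Link x p → Chunks C x p e
    Chain-realised : Chain x y → C y × Chunks C x y e
    Link-realised adjacent = cs
    Link-realised (nested c) = proj₂ (Chain-realised c)
    Chain-realised (chain l r es l' r') with Link-realised l
    ... | [] = contradiction r stop
    ... | add _ t s c rest with pop-unique t s (Link⇒Parse l' (EqSeq⇒Parse es nil)) r'
    ... | refl = c , rest

  hash-end : at (suc n) ≡ just hash
  hash-end = atV-end w

  at-defined : i ≤ suc n → ∃ λ c → at i ≡ just c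
  at-defined {zero} _ = _ , refl
  at-defined {suc i} (s≤s l) with m≤n⇒m<n∨m≡n l
  ... | inj₁ g = _ , proj₂ (atV-inside w g)
  ... | inj₂ refl = _ , atV-end w

  Chain⇒Closes : (t : Parse 0 0 (suc n)) → Chain x y → Closes t x y
  Chain⇒Closes t c with chunks t z≤n (<-≤-trans (<⇒≤ (proj₁ (Chain⇒χ c))) (Chain-bound c))
  ... | e , cs , inj₁ stop = proj₁ (Chain-realised stop cs c)
  ... | e , cs , inj₂ (refl , refl) = proj₁ (Chain-realised stop cs c)
    where
    -- Position 0 stays on top up to the end marker, and ⋖ always has a letter on its right.
    stop : ¬ Rel 0 ⋖ (suc n)
    stop r with () ← trans (≡-sym hash-end) (proj₂ (⋖-letter {0} {suc n} r))

  -- Existence of the parse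

  -- The stack of a running machine, with one unfinished parse per open level.
  data Zipper : ℕ → ℕ → Set where
    bottom : Parse 0 0 j → Zipper 0 j
    level  : Zipper h p → Rel h ⋖ p → Parse p q j → Zipper q j

  depth : Zipper h j → ℕ
  depth (bottom _) = 0
  depth (level z _ _) = suc (depth z)

  Zipper⇒Link : Zipper h j → Link h j
  Zipper⇒Link (bottom t) = Parse⇒Link t
  Zipper⇒Link (level _ _ t) = Parse⇒Link t

  close : (z : Zipper h p) → Rel h ⋖ p → Parse p q j → Rel q ⋗ j → Σ (Zipper h j) λ z' → depth z' ≡ depth z
  close (bottom t) r t' r' = bottom (node t r t' r') , refl
  close (level z s t) r t' r' = level z s (node t r t' r') , refl

  module _ (compatible : Compatible) where

    -- The two clauses of compatibility match the two kinds of link. The pair of end markers is the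
    -- one exception, and there the parse is finished.
    Link-defined : Link h j → j ≤ suc n → (h ≡ 0 × j ≡ suc n) ⊎ ∃ λ π → Rel h π j
    Link-defined {zero} adjacent l with at 1 in eq
    ... | just hash = inj₁ (refl , cong suc (atV-hash w eq))
    ... | just (sym b) = inj₂ (⋖ , refl)
    ... | nothing with () ← trans (≡-sym eq) (proj₂ (at-defined l))
    Link-defined {suc h} adjacent (s≤s l) with m≤n⇒m<n∨m≡n l
    ... | inj₁ g with precPos M (at (suc h)) (at (suc (suc h))) | proj₁ compatible (suc h) (s≤s z≤n) g
    ...   | just π | _ = inj₂ (π , refl)
    Link-defined {suc h} adjacent (s≤s l) | inj₂ refl
      rewrite proj₂ (atV-inside w l) | hash-end = inj₂ (⋗ , refl)
    Link-defined {h} {j} (nested c) l with proj₂ compatible h j c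
    ... | inj₁ d with precPos M (at h) (at j) | d
    ...   | just π | _ = inj₂ (π , refl)
    Link-defined {h} {j} (nested c) l | inj₂ (eh , ej) = inj₁ (ends eh ej (Link-< (nested c)))
      where
      ends : at i ≡ just hash → at p ≡ just hash → i < p → i ≡ 0 × p ≡ suc n
      ends {zero} {suc p} ei ep g = refl , cong suc (atV-hash w ep)
      ends {suc i} {suc p} ei ep g =
        contradiction (trans (atV-hash w ei) (≡-sym (atV-hash w ep))) (<⇒≢ (≤-pred g))

    -- `d` positions are unread. Each counts twice: a push consumes one and adds a level, for a net
    -- loss of one; a shift loses two, and a pop loses the level it closes.
    parse-from : ∀ fuel d (z : Zipper h j) → j + d ≡ suc n → d + d + depth z < fuel → Parse 0 0 (suc n)
    parse-from {j = j} (suc fuel) d z e f with Link-defined (Zipper⇒Link z) (subst (j ≤_) e (m≤m+n j d))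
    parse-from (suc fuel) d (bottom t) e f | inj₁ (refl , refl) = t
    parse-from (suc fuel) d (level z r t) e f | inj₁ (refl , refl)
      with () ← ≤-trans (Link-< (Zipper⇒Link z)) (start≤top t)
    parse-from {h} {j} (suc fuel) zero z e f | inj₂ (⋖ , r) =
      contradiction (letter-bound {j} (proj₂ (⋖-letter {h} {j} r))) (<⇒≱ (≤-reflexive (≡-sym (trans (≡-sym (+-identityʳ j)) e))))
    parse-from {h} {j} (suc fuel) (suc d) z e (s≤s f) | inj₂ (⋖ , r) =
      parse-from fuel d (level z r nil) (trans (≡-sym (+-suc j d)) e)
        (≤-trans (s≤s (≤-reflexive (trans (+-suc (d + d) (depth z)) (cong (_+ depth z) (≡-sym (+-suc d d)))))) f)
    parse-from {h} {j} (suc fuel) zero z e f | inj₂ (≐ , r) with ≐-letters {h} {j} r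
    ... | _ , _ , _ , ej = 
      contradiction (letter-bound {j} ej) (<⇒≱ (≤-reflexive (≡-sym (trans (≡-sym (+-identityʳ j)) e))))
    parse-from {j = j} (suc fuel) (suc d) (bottom t) e f | inj₂ (≐ , r) with () ← proj₁ (proj₂ (proj₂ (≐-letters {0} {j} r)))
    parse-from {h} {j} (suc fuel) (suc d) (level z s t) e (s≤s f) | inj₂ (≐ , r) =
      parse-from fuel d (level z s (shift t r)) (trans (≡-sym (+-suc j d)) e)
        (≤-trans (s≤s (+-monoˡ-≤ (suc (depth z)) (+-monoʳ-≤ d (n≤1+n d)))) f)
    parse-from {j = j} (suc fuel) d (bottom t) e f | inj₂ (⋗ , r) with () ← proj₂ (⋗-letter {0} {j} r)
    parse-from {h} {j} (suc fuel) d (level z s t) e (s≤s f) | inj₂ (⋗ , r) with close z s t r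
    ... | z' , dz = parse-from fuel d z' e
        (≤-trans (≤-reflexive (trans (cong (λ v → suc (d + d + v)) dz) (≡-sym (+-suc (d + d) (depth z))))) f)

    parse : Parse 0 0 (suc n)
    parse = parse-from _ n (bottom nil) refl ≤-refl

-- Boolean reflection and the counting automaton

T-not : ∀ {b} → T (not b) ⇔ (¬ T b)
T-not {true} = mk⇔ (λ ()) (λ f → f tt)
T-not {false} = mk⇔ (λ _ ()) (λ _ → tt)

T-imp : ∀ {b c} → T (not b ∨ c) ⇔ (T b → T c)
T-imp {true} = mk⇔ (λ c _ → c) (λ f → f tt)
T-imp {false} = mk⇔ (λ _ ()) (λ _ → tt)

≡⇔ : ∀ {b c} → b ≡ c → T b ⇔ T c
≡⇔ refl = ⇔.refl

T-≡ : ∀ {b} → T b → b ≡ true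
T-≡ {true} _ = refl

¬T-≡ : ∀ {b} → ¬ T b → b ≡ false
¬T-≡ {true} f = contradiction tt f
¬T-≡ {false} f = refl

data Count : Set where
  none one many : Count

countFinite : Finite Count
countFinite =
  retract (maybeFinite boolFinite)
    (λ { none → nothing ; one → just false ; many → just true })
    (λ { nothing → none ; (just false) → one ; (just true) → many })
    (λ { none → refl ; one → refl ; many → refl })

isOne isMany : Count → Bool
isOne one = true
isOne _ = false
isMany many = true
isMany _ = false

-- Used in two ways: with `X` and `Y` equal, `one` means that exactly one position satisfies `X`;
-- with the marks of x and y, `many` means x < y. The step out of `none` does not look at `Y`, which
-- makes the inequality strict.
countStep : (L → Bool) → (L → Bool) → Count → L → Count
countStep X Y none l = if X l then one else none
countStep X Y one  l = if Y l then many else one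
countStep X Y many l = many

countMach : (L → Bool) → (L → Bool) → (Count → Bool) → Mach L
countMach X Y = linear countFinite none (countStep X Y)

-- A product with itself whose verdict reads one component, so that `accept-product` already proves
-- it correct.
complement : Mach L → Mach L
complement A = product (λ a _ → not a) A A

-- Monadic second-order logic over OP words

module _ (k m : ℕ) where

  -- Fm f s has f free position variables and s free set variables.
  data Fm (f s : ℕ) : Set where
    rel : (Maybe (Sym k m) → Maybe (Sym k m) → Bool) → Fin f → Fin f → Fm f s
    mem : Fin f → Fin s → Fm f s
    lt  : Fin f → Fin f → Fm f s
    chn : Fin f → Fin f → Fm f s
    neg : Fm f s → Fm f s
    _and_ _or_ _imp_ : Fm f s → Fm f s → Fm f s
    ex all : Fm (suc f) s → Fm f s
    allSet : Fm f (suc s) → Fm f s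

  infixr 6 _and_
  infixr 5 _or_
  infixr 4 _imp_

  Datum : ℕ → Set
  Datum s = Maybe (Sym k m) × Vec Bool s

  Label : ℕ → ℕ → Set
  Label f s = Maybe (Sym k m) × Vec Bool f × Vec Bool s

-- Compilation of formulas into machines

module _ {k m : ℕ} where

  private variable
    f s : ℕ

  marked : Fin f → Label k m f s → Bool
  marked x (_ , v , _) = lookup v x

  datumFinite : Finite (Datum k m s)
  datumFinite {s} = ×-finite (maybeFinite (symFinite k m)) (vecFinite boolFinite s)

  testStep : Fin f → Fin f → Datum k m s × Datum k m s → Label k m f s → Datum k m s × Datum k m s
  testStep x y (d , d') l@(c , _ , u) =
    (if marked x l then (c , u) else d) , (if marked y l then (c , u) else d')

  testMach : (Datum k m s → Datum k m s → Bool) → Fin f → Fin f → Mach (Label k m f s)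
  testMach p x y =
    -- These initial data are overwritten: free variables denote positions of the word, so each mark
    -- is met before the verdict.
    linear (×-finite datumFinite datumFinite) ((nothing , replicate _ false) , (nothing , replicate _ false))
           (testStep x y) (λ (d , d') → p d d')

  -- The three bits, j being the next input: is (x, y) a closed chain with y read,
  -- is x on top of the stack, has a chain with context (x, j) been closed.
  chainMach : Fin f → Fin f → Mach (Label k m f s)
  chainMach x y = record
    { Q = Bool × Bool × Bool
    ; finite = ×-finite boolFinite (×-finite boolFinite boolFinite)
    ; ini = λ l → false , marked x l , false
    ; push = read
    ; shift = read
    -- The pop uncovers the saved top, so `o` comes from the saved state, and it closes a chain from
    -- that top to the unread input, hence `c ∨ o`. `g` records what has been read and comes from
    -- the current state.
    ; pop = λ (g , _ , c) (_ , o , _) → g , o , c ∨ o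
    ; fin = λ (g , _ , c) l → g ∨ (c ∧ marked y l) }
    where
    read : Bool × Bool × Bool → _ → Bool × Bool × Bool
    -- The pending bit is settled by the position being read and cleared, because the next input is
    -- now another one.
    read (g , _ , c) l = g ∨ (c ∧ marked y l) , marked x l , false

  addMark : Bool → Label k m f s → Label k m (suc f) s
  addMark b (c , v , u) = c , b ∷ v , u

  addBit : Bool → Label k m f s → Label k m f (suc s)
  addBit b (c , v , u) = c , v , b ∷ u

  -- A position is treated as a singleton set: the mark is guessed as a track, and counting ensures
  -- that exactly one position carries it.
  existsMach : Mach (Label k m (suc f) s) → Mach (Label k m f s)
  existsMach A = project addMark (product _∧_ (countMach (marked zero) (marked zero) isOne) A)

  compile : Fm k m f s → Mach (Label k m f s)
  compile (rel p x y) = testMach (λ (c , _) (d , _) → p c d) x y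
  compile (mem x X) = testMach (λ (_ , u) _ → lookup u X) x x
  compile (lt x y) = countMach (marked x) (marked y) isMany
  compile (chn x y) = chainMach x y
  compile (neg F) = complement (compile F)
  compile (F and G) = product _∧_ (compile F) (compile G)
  compile (F or G) = product _∨_ (compile F) (compile G)
  compile (F imp G) = product (λ a b → not a ∨ b) (compile F) (compile G)
  compile (ex F) = existsMach (compile F)
  compile (all F) = complement (existsMach (complement (compile F)))
  compile (allSet F) = complement (project addBit (complement (compile F)))

-- Semantics of the logic and correctness of compilation

module Logic {k m : ℕ} (M : Mat m) {n : ℕ} (w : Vec (Letter k m) n) where
  open Semantics M w
  open Evaluation M w
  open Parsing M w

  private variable
    f s a h j : ℕ

  ⟦_⟧ : Fm k m f s → Vec ℕ f → Vec (ℕ → Bool) s → Set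
  ⟦ rel p x y ⟧ ρ σ = T (p (at (lookup ρ x)) (at (lookup ρ y)))
  ⟦ mem x X ⟧ ρ σ = T (lookup σ X (lookup ρ x))
  ⟦ lt x y ⟧ ρ σ = lookup ρ x < lookup ρ y
  ⟦ chn x y ⟧ ρ σ = Chain (lookup ρ x) (lookup ρ y)
  ⟦ neg F ⟧ ρ σ = ¬ ⟦ F ⟧ ρ σ
  ⟦ F and G ⟧ ρ σ = ⟦ F ⟧ ρ σ × ⟦ G ⟧ ρ σ
  ⟦ F or G ⟧ ρ σ = ⟦ F ⟧ ρ σ ⊎ ⟦ G ⟧ ρ σ
  ⟦ F imp G ⟧ ρ σ = ⟦ F ⟧ ρ σ → ⟦ G ⟧ ρ σ
  ⟦ ex F ⟧ ρ σ = ∃ λ i → i ≤ suc n × ⟦ F ⟧ (i ∷ ρ) σ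
  ⟦ all F ⟧ ρ σ = ∀ i → i ≤ suc n → ⟦ F ⟧ (i ∷ ρ) σ
  ⟦ allSet F ⟧ ρ σ = ∀ X → ⟦ F ⟧ ρ (X ∷ σ)

  datum : Vec (ℕ → Bool) s → ℕ → Datum k m s
  datum σ i = at i , map (λ X → X i) σ

  label : Vec ℕ f → Vec (ℕ → Bool) s → ℕ → Label k m f s
  label ρ σ i = at i , map (i ≡ᵇ_) ρ , map (λ X → X i) σ

  InRange : Vec ℕ f → Set
  InRange = All (_≤ suc n)

  marked-label : ∀ x (ρ : Vec ℕ f) (σ : Vec (ℕ → Bool) s) i → marked x (label ρ σ i) ≡ (i ≡ᵇ lookup ρ x)
  marked-label x ρ σ i = lookup-map x (i ≡ᵇ_) ρ

  T-marked : ∀ x (ρ : Vec ℕ f) (σ : Vec (ℕ → Bool) s) {i} → T (marked x (label ρ σ i)) ⇔ i ≡ lookup ρ x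
  T-marked x ρ σ {i} =
    mk⇔ (λ e → ≡ᵇ⇒≡ i _ (subst T (marked-label x ρ σ i) e))
        (λ e → subst T (≡-sym (marked-label x ρ σ i)) (≡⇒≡ᵇ i _ e))

  -- Correctness of the atomic machines

  module _ (ρ : Vec ℕ f) (σ : Vec (ℕ → Bool) s) where

    remember : ∀ x {j d} → (lookup ρ x < j → d ≡ datum σ (lookup ρ x)) → lookup ρ x < suc j →
               (if marked x (label ρ σ j) then datum σ j else d) ≡ datum σ (lookup ρ x)
    remember x {j} old l with marked x (label ρ σ j) in eq
    ... | true = cong (datum σ) (to (T-marked x ρ σ) (subst T (≡-sym eq) tt))
    ... | false = old (≤∧≢⇒< (≤-pred l) λ e → subst T eq (from (T-marked x ρ σ) (≡-sym e)))

    accept-test : InRange ρ → ∀ p x y t →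
      accept (testMach p x y) (label ρ σ) t ≡ p (datum σ (lookup ρ x)) (datum σ (lookup ρ y))
    accept-test R p x y t
      with accept-linear _ _ (testStep x y) (λ (d , d') → p d d') (label ρ σ)
             (λ j (d , d') → (lookup ρ x < j → d ≡ datum σ (lookup ρ x))
                           × (lookup ρ y < j → d' ≡ datum σ (lookup ρ y)))
             (λ _ (u , v) → remember x u , remember y v)
             ((λ ()) , (λ ())) t
    ... | _ , (u , v) , eq = trans eq (cong₂ p (u (s≤s (lookup⁺ R x))) (v (s≤s (lookup⁺ R y))))

  module _ (X Y : L → Bool) (lab : ℕ → L) where

    CountInv : ℕ → Count → Set
    CountInv j none = ∀ i → i < j → ¬ T (X (lab i))
    CountInv j one = ∃ λ i → i < j × T (X (lab i)) × (∀ h → h < i → ¬ T (X (lab h)))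
                                 × (∀ h → i < h → h < j → ¬ T (Y (lab h)))
    CountInv j many = ∃ λ i → ∃ λ h → i < h × h < j × T (X (lab i)) × T (Y (lab h))

    CountInv-step : ∀ {j c} → CountInv j c → CountInv (suc j) (countStep X Y c (lab j))
    CountInv-step {j} {none} v with X (lab j) in eq
    ... | true = j , ≤-refl , subst T (≡-sym eq) tt , v , λ h l g → contradiction (≤-trans g l) 1+n≰n
    ... | false = before
      where
      before : ∀ i → i < suc j → ¬ T (X (lab i))
      before i i≤j Xi with m<1+n⇒m<n∨m≡n i≤j
      ... | inj₁ i<j = v i i<j Xi
      ... | inj₂ refl = subst T eq Xi
    CountInv-step {j} {one} (i , l , Xi , before , after) with Y (lab j) in eq
    ... | true = i , j , l , ≤-refl , Xi , subst T (≡-sym eq) tt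
    ... | false = i , m<n⇒m<1+n l , Xi , before , after'
      where
      after' : ∀ h → i < h → h < suc j → ¬ T (Y (lab h))
      after' h i<h h≤j Yh with m<1+n⇒m<n∨m≡n h≤j
      ... | inj₁ h<j = after h i<h h<j Yh
      ... | inj₂ refl = subst T eq Yh
    CountInv-step {j} {many} (i , h , i<h , h<j , v) = i , h , i<h , m<n⇒m<1+n h<j , v

    accept-count : ∀ acc t → ∃ λ c → CountInv (suc (suc n)) c × accept (countMach X Y acc) lab t ≡ acc c
    accept-count acc t = accept-linear countFinite none (countStep X Y) acc lab CountInv (λ {j} {c} _ → CountInv-step {j} {c}) (λ _ ()) t

  accept-lt : {ρ : Vec ℕ f} {σ : Vec (ℕ → Bool) s} → InRange ρ → ∀ x y t →
    T (accept (countMach (marked x) (marked y) isMany) (label ρ σ) t) ⇔ lookup ρ x < lookup ρ y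
  accept-lt {ρ = ρ} {σ} R x y t with accept-count (marked x) (marked y) (label ρ σ) isMany t
  ... | none , v , eq rewrite eq =
    mk⇔ (λ ()) λ _ → v _ (s≤s (lookup⁺ R x)) (from (T-marked x ρ σ) refl)
  ... | one , (i , _ , Xi , _ , after) , eq rewrite eq =
    mk⇔ (λ ()) λ l → after _ (subst (_< lookup ρ y) (≡-sym (to (T-marked x ρ σ) Xi)) l)
                           (s≤s (lookup⁺ R y)) (from (T-marked y ρ σ) refl)
  ... | many , (i , h , i<h , _ , Xi , Yh) , eq rewrite eq =
    mk⇔ (λ _ → subst₂ _<_ (to (T-marked x ρ σ) Xi) (to (T-marked y ρ σ) Yh) i<h) (λ _ → tt)

  Singleton : (ℕ → Bool) → Set
  Singleton X = ∃ λ i → i ≤ suc n × ∀ p → p ≤ suc n → X p ≡ (p ≡ᵇ i)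

  accept-single : (X : L → Bool) (lab : ℕ → L) (t : Parse 0 0 (suc n)) →
    T (accept (countMach X X isOne) lab t) ⇔ Singleton (X ∘ lab)
  accept-single X lab t with accept-count X X lab isOne t
  ... | none , v , eq rewrite eq =
    mk⇔ (λ ()) λ (i , l , E) → v i (s≤s l) (subst T (≡-sym (E i l)) (≡⇒≡ᵇ i i refl))
  ... | many , (i , h , i<h , h< , Xi , Xh) , eq rewrite eq = mk⇔ (λ ()) λ S → <⇒≢ i<h (unique S)
    where
    unique : Singleton (X ∘ lab) → i ≡ h
    unique (p , _ , E) =
      trans (≡ᵇ⇒≡ i p (subst T (E i (≤-pred (<-trans i<h h<))) Xi))
            (≡-sym (≡ᵇ⇒≡ h p (subst T (E h (≤-pred h<)) Xh)))
  ... | one , (i , l , Xi , before , after) , eq rewrite eq =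
    mk⇔ (λ _ → i , ≤-pred l , E) (λ _ → tt)
    where
    E : ∀ p → p ≤ suc n → X (lab p) ≡ (p ≡ᵇ i)
    E p p≤ with <-cmp p i
    ... | tri< p<i p≢i _ = trans (¬T-≡ (before p p<i)) (≡-sym (¬T-≡ (p≢i ∘ ≡ᵇ⇒≡ p i)))
    ... | tri≈ _ refl _ = trans (T-≡ Xi) (≡-sym (T-≡ (≡⇒≡ᵇ i i refl)))
    ... | tri> _ p≢i i<p = trans (¬T-≡ (after p i<p (s≤s p≤))) (≡-sym (¬T-≡ (p≢i ∘ ≡ᵇ⇒≡ p i)))

  module _ (ρ : Vec ℕ f) (σ : Vec (ℕ → Bool) s) (x y : Fin f) where
    private
      X Y : ℕ
      X = lookup ρ x
      Y = lookup ρ y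
      lab : ℕ → Label k m f s
      lab = label ρ σ
      C : Mach (Label k m f s)
      C = chainMach x y

    good-read : ∀ {G : Set} {D : ℕ → Set} {g c j} → T g ⇔ (G ⊎ D Y × Y < j) → T c ⇔ D j →
                T (g ∨ (c ∧ marked y (lab j))) ⇔ (G ⊎ D Y × Y < suc j)
    good-read {G} {D} {g} {c} {j} eg ec = mk⇔ fwd bwd
      where
      fwd : T (g ∨ (c ∧ marked y (lab j))) → G ⊎ D Y × Y < suc j
      fwd v with to T-∨ v
      ... | inj₁ v₁ with to eg v₁
      ...   | inj₁ γ = inj₁ γ
      ...   | inj₂ (d , l) = inj₂ (d , m<n⇒m<1+n l)
      fwd v | inj₂ v₂ with to T-∧ v₂
      ... | vc , vy with to (T-marked y ρ σ {j}) vy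
      ... | refl = inj₂ (to ec vc , ≤-refl)
      bwd : G ⊎ D Y × Y < suc j → T (g ∨ (c ∧ marked y (lab j)))
      bwd (inj₁ γ) = from T-∨ (inj₁ (from eg (inj₁ γ)))
      bwd (inj₂ (d , l)) with m<1+n⇒m<n∨m≡n l
      ... | inj₁ l' = from T-∨ (inj₁ (from eg (inj₂ (d , l'))))
      ... | inj₂ refl = from (T-∨ {g}) (inj₂ (from T-∧ (from ec d , from (T-marked y ρ σ) refl)))

    -- `G` is what `g` said on entering the level. A chain ending in `j` can be closed while `j` is
    -- unread, so `g` covers only `Y < j`, and `c` carries the pending case.
    ChainInv : Set → Parse a h j → Mach.Q C → Set
    ChainInv {h = h} {j = j} G t (g , o , c) =
      T o ⇔ h ≡ X × T c ⇔ Closes t X j × T g ⇔ (G ⊎ Closes t X Y × Y < j)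

    eval-chain : ∀ {g o} (t : Parse a h j) → T o ⇔ a ≡ X →
                 ChainInv (T g) t (eval C lab (g , o , false) t)
    eval-chain nil eo = eo , mk⇔ (λ ()) (λ ()) , mk⇔ inj₁ λ { (inj₁ v) → v ; (inj₂ (() , _)) }
    eval-chain (shift t _) eo with eval-chain t eo
    ... | _ , ec , eg =
      T-marked x ρ σ
      , mk⇔ (λ ()) (λ c → contradiction (Closes-bound t c) 1+n≰n)
      , good-read {D = Closes t X} eg ec
    eval-chain {g = g} {o} (node {h = h} {p = p} {j = j} t _ t' _) eo =
      eo₁ , mk⇔ fwd bwd , mk⇔ gfwd gbwd
      where
      s₁ = eval C lab (g , o , false) t
      o₁ = proj₁ (proj₂ s₁)
      v₁ = eval-chain {g = g} t eo
      eo₁ = proj₁ v₁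
      ec₁ = proj₁ (proj₂ v₁)
      eg₁ = proj₂ (proj₂ v₁)
      s₂ = eval C lab (Mach.push C s₁ (lab p)) t'
      g₂ = proj₁ s₂
      c₂ = proj₂ (proj₂ s₂)
      -- The inner level takes as its `G` everything known outside once `p` is read, so nothing is
      -- lost when the pop drops the saved `g`.
      v₂ = eval-chain {g = proj₁ (Mach.push C s₁ (lab p))} t' (T-marked x ρ σ)
      ec₂ = proj₁ (proj₂ v₂)
      eg₂ = proj₂ (proj₂ v₂)
      p<j = start<next t'
      eg = good-read {D = Closes t X} eg₁ ec₁
      fwd : T (c₂ ∨ o₁) → Closes t X j ⊎ Closes t' X j ⊎ (X ≡ h × j ≡ j)
      fwd v with to T-∨ v
      ... | inj₁ v₁ = inj₂ (inj₁ (to ec₂ v₁))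
      ... | inj₂ v₂ = inj₂ (inj₂ (≡-sym (to eo₁ v₂) , refl))
      bwd : Closes t X j ⊎ Closes t' X j ⊎ (X ≡ h × j ≡ j) → T (c₂ ∨ o₁)
      bwd (inj₁ c) = contradiction (Closes-bound t c) (<⇒≱ p<j)
      bwd (inj₂ (inj₁ c)) = from T-∨ (inj₁ (from ec₂ c))
      bwd (inj₂ (inj₂ (e , _))) = from (T-∨ {c₂}) (inj₂ (from eo₁ (≡-sym e)))
      gfwd : T g₂ → T g ⊎ (Closes t X Y ⊎ Closes t' X Y ⊎ (X ≡ h × Y ≡ j)) × Y < j
      gfwd v with to eg₂ v
      ... | inj₂ (c , l) = inj₂ (inj₂ (inj₁ c) , l)
      ... | inj₁ v' with to eg v'
      ...   | inj₁ γ = inj₁ γ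
      ...   | inj₂ (c , l) = inj₂ (inj₁ c , ≤-trans l p<j)
      gbwd : T g ⊎ (Closes t X Y ⊎ Closes t' X Y ⊎ (X ≡ h × Y ≡ j)) × Y < j → T g₂
      gbwd (inj₁ γ) = from eg₂ (inj₁ (from eg (inj₁ γ)))
      gbwd (inj₂ (inj₁ c , l)) = from eg₂ (inj₁ (from eg (inj₂ (c , s≤s (Closes-bound t c)))))
      gbwd (inj₂ (inj₂ (inj₁ c) , l)) = from eg₂ (inj₂ (c , l))
      gbwd (inj₂ (inj₂ (inj₂ (_ , refl)) , l)) = contradiction l (<-irrefl refl)

    opaque
      unfolding accept
      accept-chain : InRange ρ → (t : Parse 0 0 (suc n)) → T (accept C lab t) ⇔ Chain X Y
      accept-chain R t with eval-chain {g = false} t (T-marked x ρ σ)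
      ... | _ , ec , eg = mk⇔ fwd (λ ch → from final (inj₂ (Chain⇒Closes t ch , s≤s (lookup⁺ R y))))
        where
        -- `fin` acts as a read of the end marker, which settles the chains that end at `suc n`.
        final : T (accept C lab t) ⇔ (⊥ ⊎ Closes t X Y × Y < suc (suc n))
        final = good-read {D = Closes t X} eg ec
        fwd : T (accept C lab t) → Chain X Y
        fwd v with to final v
        ... | inj₂ (cl , _) = Closes⇒Chain t cl

  accept-exists : (A : Mach (Label k m (suc f) s)) (ρ : Vec ℕ f) (σ : Vec (ℕ → Bool) s)
    (t : Parse 0 0 (suc n)) →
    T (accept (existsMach A) (label ρ σ) t) ⇔ (∃ λ i → i ≤ suc n × T (accept A (label (i ∷ ρ) σ) t))
  accept-exists A ρ σ t = mk⇔ fwd bwd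
    where
    S = countMach (marked zero) (marked zero) isOne
    tracked : (ℕ → Bool) → ℕ → Label k m _ _
    tracked = withTrack addMark (product _∧_ S A) (label ρ σ)
    fwd : T (accept (existsMach A) (label ρ σ) t) → ∃ λ i → i ≤ suc n × T (accept A (label (i ∷ ρ) σ) t)
    fwd v with to (accept-project addMark (product _∧_ S A) (label ρ σ) t) v
    ... | X , v' with to T-∧ (subst T (accept-product _∧_ S A (tracked X) t) v')
    ... | vs , va with to (accept-single (marked zero) (tracked X) t) vs
    -- The guessed track agrees with `_≡ᵇ i` on the positions of the word, which is all that
    -- acceptance depends on.
    ... | i , l , E = i , l , subst T (accept-cong A t λ p p≤ → cong (λ b → addMark b (label ρ σ p)) (E p p≤)) va
    bwd : (∃ λ i → i ≤ suc n × T (accept A (label (i ∷ ρ) σ) t)) → T (accept (existsMach A) (label ρ σ) t)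
    bwd (i , l , va) = from (accept-project addMark (product _∧_ S A) (label ρ σ) t)
      ((_≡ᵇ i) , subst T (≡-sym (accept-product _∧_ S A (label (i ∷ ρ) σ) t))
        (from T-∧ (from (accept-single (marked zero) (label (i ∷ ρ) σ) t) (i , l , λ _ _ → refl) , va)))

  accept-complement : (A : Mach L) (lab : ℕ → L) (t : Parse 0 0 (suc n)) →
    T (accept (complement A) lab t) ⇔ (¬ T (accept A lab t))
  accept-complement A lab t = ⇔.trans (≡⇔ (accept-product (λ a _ → not a) A A lab t)) T-not

  compile-correct : (F : Fm k m f s) {ρ : Vec ℕ f} {σ : Vec (ℕ → Bool) s} → InRange ρ →
    (t : Parse 0 0 (suc n)) → T (accept (compile F) (label ρ σ) t) ⇔ ⟦ F ⟧ ρ σ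
  compile-correct (rel p x y) {ρ} {σ} R t = ≡⇔ (accept-test ρ σ R (λ (c , _) (d , _) → p c d) x y t)
  compile-correct (mem x X) {ρ} {σ} R t =
    ≡⇔ (trans (accept-test ρ σ R (λ (_ , u) _ → lookup u X) x x t) (lookup-map X (λ Z → Z (lookup ρ x)) σ))
  compile-correct (lt x y) R t = accept-lt R x y t
  compile-correct (chn x y) {ρ} {σ} R t = accept-chain ρ σ x y R t
  compile-correct (neg F) {ρ} {σ} R t =
    ⇔.trans (accept-complement (compile F) (label ρ σ) t) (¬-cong-⇔ (compile-correct F R t))
  compile-correct (F and G) {ρ} {σ} R t =
    ⇔.trans (≡⇔ (accept-product _∧_ (compile F) (compile G) (label ρ σ) t))
      (⇔.trans T-∧ (compile-correct F R t ×-⇔ compile-correct G R t))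
  compile-correct (F or G) {ρ} {σ} R t =
    ⇔.trans (≡⇔ (accept-product _∨_ (compile F) (compile G) (label ρ σ) t))
      (⇔.trans T-∨ (compile-correct F R t ⊎-⇔ compile-correct G R t))
  compile-correct (F imp G) {ρ} {σ} R t =
    ⇔.trans (≡⇔ (accept-product (λ a b → not a ∨ b) (compile F) (compile G) (label ρ σ) t))
      (⇔.trans T-imp (→-cong-⇔ (compile-correct F R t) (compile-correct G R t)))
  compile-correct (ex F) {ρ} {σ} R t =
    ⇔.trans (accept-exists (compile F) ρ σ t)
      (mk⇔ (λ (i , l , v) → i , l , to (compile-correct F (l ∷ R) t) v)
           (λ (i , l , v) → i , l , from (compile-correct F (l ∷ R) t) v))
  compile-correct (all F) {ρ} {σ} R t = ⇔.trans (accept-complement E (label ρ σ) t) (mk⇔ fwd bwd)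
    where
    E = existsMach (complement (compile F))
    fwd : ¬ T (accept E (label ρ σ) t) → ∀ i → i ≤ suc n → ⟦ F ⟧ (i ∷ ρ) σ
    -- Acceptance is Boolean, hence stable under double negation.
    fwd v i l = to (compile-correct F (l ∷ R) t) (decidable-stable (T? _) λ v' →
      v (from (accept-exists (complement (compile F)) ρ σ t)
              (i , l , from (accept-complement (compile F) (label (i ∷ ρ) σ) t) v')))
    bwd : (∀ i → i ≤ suc n → ⟦ F ⟧ (i ∷ ρ) σ) → ¬ T (accept E (label ρ σ) t)
    bwd v v' with to (accept-exists (complement (compile F)) ρ σ t) v'
    ... | i , l , v'' =
      to (accept-complement (compile F) (label (i ∷ ρ) σ) t) v'' (from (compile-correct F (l ∷ R) t) (v i l))
  compile-correct (allSet F) {ρ} {σ} R t = ⇔.trans (accept-complement E (label ρ σ) t) (mk⇔ fwd bwd)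
    where
    E = project addBit (complement (compile F))
    fwd : ¬ T (accept E (label ρ σ) t) → ∀ X → ⟦ F ⟧ ρ (X ∷ σ)
    fwd v X = to (compile-correct F R t) (decidable-stable (T? _) λ v' →
      v (from (accept-project addBit (complement (compile F)) (label ρ σ) t)
              (X , from (accept-complement (compile F) (label ρ (X ∷ σ)) t) v')))
    bwd : (∀ X → ⟦ F ⟧ ρ (X ∷ σ)) → ¬ T (accept E (label ρ σ) t)
    bwd v v' with to (accept-project addBit (complement (compile F)) (label ρ σ) t) v'
    ... | X , v'' =
      to (accept-complement (compile F) (label ρ (X ∷ σ)) t) v'' (from (compile-correct F R t) (v X))

-- Translation of POTL

holds : ∀ {k m} → Fin k ⊎ Fin m → Maybe (Sym k m) → Bool
holds (inj₁ a) (just (sym (N , _))) = lookup N a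
holds (inj₂ a) (just (sym (_ , S))) = lookup S a
holds _ _ = false

inΠ : PrecSet → Maybe Prec → Bool
inΠ Π nothing = false
inΠ Π (just ⋖) = PrecSet.hasY Π
inΠ Π (just ≐) = PrecSet.hasE Π
inΠ Π (just ⋗) = PrecSet.hasT Π

is⋖ is⋗ : Maybe Prec → Bool
is⋖ (just ⋖) = true
is⋖ _ = false
is⋗ (just ⋗) = true
is⋗ _ = false

T-inΠ : ∀ Π z → T (inΠ Π z) ⇔ (∃ λ π → π ∈P Π × z ≡ just π)
T-inΠ Π nothing = mk⇔ (λ ()) λ { (_ , _ , ()) }
T-inΠ Π (just ⋖) = mk⇔ (λ v → _ , v , refl) λ { (_ , v , refl) → v }
T-inΠ Π (just ≐) = mk⇔ (λ v → _ , v , refl) λ { (_ , v , refl) → v }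
T-inΠ Π (just ⋗) = mk⇔ (λ v → _ , v , refl) λ { (_ , v , refl) → v }

T-is⋖ : ∀ z → T (is⋖ z) ⇔ z ≡ just ⋖
T-is⋖ nothing = mk⇔ (λ ()) (λ ())
T-is⋖ (just ⋖) = mk⇔ (λ _ → refl) _
T-is⋖ (just ≐) = mk⇔ (λ ()) (λ ())
T-is⋖ (just ⋗) = mk⇔ (λ ()) (λ ())

T-is⋗ : ∀ z → T (is⋗ z) ⇔ z ≡ just ⋗
T-is⋗ nothing = mk⇔ (λ ()) (λ ())
T-is⋗ (just ⋖) = mk⇔ (λ ()) (λ ())
T-is⋗ (just ≐) = mk⇔ (λ ()) (λ ())
T-is⋗ (just ⋗) = mk⇔ (λ _ → refl) _

pattern #0 = zero
pattern #1 = suc zero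
pattern #2 = suc (suc zero)

module _ {k m : ℕ} (M : Mat m) where

  private variable
    f s : ℕ

  relΠ : PrecSet → Fin f → Fin f → Fm k m f s
  relΠ Π = rel λ c d → inΠ Π (precPos M c d)

  le : Fin f → Fin f → Fm k m f s
  le x y = neg (lt y x)

  next : Fin f → Fin f → Fm k m f s
  next x y = lt x y and all (neg (lt (suc x) zero and lt zero (suc y)))

  inK : PrecSet → Fin f → Fin f → Fin f → Fm k m f s
  inK Π b x h = le h b and chn x h and relΠ Π x h

  sumStep : PrecSet → Fin f → Fin f → Fin f → Fm k m f s
  sumStep Π b x y =
       (inK Π b x y and all (inK Π (suc b) (suc x) zero imp le zero (suc y)))
    or (all (neg (inK Π (suc b) (suc x) zero)) and next x y and relΠ Π x y)

  hset : HPrec → Fin f → Fin f → Fm k m f s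
  hset yieldH h x = chn h x and rel (λ c d → is⋖ (precPos M c d)) h x
  hset takeH  h x = chn x h and rel (λ c d → is⋗ (precPos M c d)) x h

  hchn : HPrec → Fin f → Fin f → Fm k m f s
  hchn yieldH h x = chn h x
  hchn takeH  h x = chn x h

  hstep : HPrec → Fin f → Fin f → Fin f → Fm k m f s
  hstep μ h x y = all (lt (suc x) zero imp lt zero (suc y) imp neg (hchn μ (suc h) zero))

  -- x lies in every set that contains b (if base holds) and is closed under
  -- predecessors along step, whose two innermost variables are target and source.
  reach : Fm k m f (suc s) → Fin f → Fm k m (suc (suc f)) (suc s) → Fin f → Fm k m f s
  reach base b step x = allSet
    ((base imp mem b zero)
      imp all (all (step imp mem zero zero imp mem (suc zero) zero))
      imp mem x zero)

  translate : Formula k m → Fin f → Fm k m f s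
  translate (atom a) x = rel (λ c _ → holds a c) x x
  translate (¬F φ) x = neg (translate φ x)
  translate (φ ∨F ψ) x = translate φ x or translate ψ x
  translate (nextΠ Π φ) x = ex (next (suc x) #0 and relΠ Π (suc x) #0 and translate φ #0)
  translate (backΠ Π φ) x = ex (next #0 (suc x) and relΠ Π #0 (suc x) and translate φ #0)
  translate (χF Π φ) x = ex (chn (suc x) #0 and relΠ Π (suc x) #0 and translate φ #0)
  translate (χP Π φ) x = ex (chn #0 (suc x) and relΠ Π #0 (suc x) and translate φ #0)
  -- The endpoint is fixed before the path, since every summary step is relative to it.
  translate (Uχ Π φ ψ) x = ex (le (suc x) #0 and
    reach (translate ψ #0) #0 (translate φ #1 and lt #1 #0 and sumStep Π #2 #1 #0) (suc x))
  translate (Sχ Π φ ψ) x = ex (le #0 (suc x) and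
    reach (translate ψ #0) #0
          -- For since, the closed set is followed backwards from `x`: the source is the later
          -- position, and the endpoint governing the summary steps is `x` itself, here under three
          -- binders.
          (translate φ #1 and lt #0 #1 and sumStep Π (suc (suc (suc x))) #0 #1) (suc x))
  translate (nextH μ φ) x = ex (hset μ #0 (suc x) and ex (
    lt (suc (suc x)) #0 and hset μ #1 #0 and
    all (lt (suc (suc (suc x))) #0 imp hset μ #2 #0 imp le #1 #0) and translate φ #0))
  translate (backH μ φ) x = ex (hset μ #0 (suc x) and ex (
    lt #0 (suc (suc x)) and hset μ #1 #0 and
    all (lt #0 (suc (suc (suc x))) imp hset μ #2 #0 imp le #0 #1) and translate φ #0))
  translate (UH μ φ ψ) x = ex (le (suc x) #0 and ex (
    reach (hset μ #0 #1 and translate ψ #1) #1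
          (hset μ #2 #1 and translate φ #1 and lt #1 #0 and hstep μ #2 #1 #0) (suc (suc x))))
  translate (SH μ φ ψ) x = ex (le #0 (suc x) and ex (
    reach (hset μ #0 #1 and translate ψ #1) #1
          (hset μ #2 #1 and translate φ #1 and lt #0 #1 and hstep μ #2 #0 #1) (suc (suc x))))

-- Correctness of the translation

module Translation {k m : ℕ} (M : Mat m) {n : ℕ} (w : Vec (Letter k m) n)
                   (compatible : Semantics.Compatible M w) where
  open Semantics M w
  open Evaluation M w
  open Parsing M w
  open Logic M w

  private variable
    f s : ℕ
    P Q : ℕ → Set

  private
    N : ℕ
    N = suc n

  -- Running the compiled machine takes the place of excluded middle; compatibility enters because
  -- it supplies the parse.
  ⟦_⟧? : (F : Fm k m f s) {ρ : Vec ℕ f} {σ : Vec (ℕ → Bool) s} → InRange ρ → Dec (⟦ F ⟧ ρ σ)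
  ⟦ F ⟧? R = map′ (to correct) (from correct) (T? _)
    where correct = compile-correct F R (parse compatible)

  -- The semantics of POTL quantifies over all naturals, the logic over positions only; the second
  -- argument confines every witness to the word.
  ∃≤ : (∀ i → i ≤ N → P i ⇔ Q i) → (∀ i → Q i → i ≤ N) → (∃ λ i → i ≤ N × P i) ⇔ ∃ Q
  ∃≤ e b = mk⇔ (λ (i , l , v) → i , to (e i l) v) (λ (i , v) → i , b i v , from (e i (b i v)) v)

  ∀≤ : (∀ i → i ≤ N → P i ⇔ Q i) → (∀ i → ¬ i ≤ N → Q i) → (∀ i → i ≤ N → P i) ⇔ (∀ i → Q i)
  ∀≤ {P} {Q} e out = mk⇔ fwd (λ v i l → from (e i l) (v i))
    where
    fwd : (∀ i → i ≤ N → P i) → ∀ i → Q i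
    fwd v i with i ≤? N
    ... | yes l = to (e i l) (v i l)
    ... | no ¬l = out i ¬l

  -- The least closed set, halfway between the second-order formula and the two kinds of path. Its
  -- bounds mirror the bounded quantifiers of `reach`.
  data Reach (Base : Set) (R : ℕ → ℕ → Set) (b : ℕ) : ℕ → Set where
    here  : Base → Reach Base R b b
    there : ∀ {a a'} → a ≤ N → a' ≤ N → R a a' → Reach Base R b a' → Reach Base R b a

  module _ {Base : Set} {R : ℕ → ℕ → Set} {b : ℕ} (base? : Dec Base)
           (R? : ∀ {a a'} → a ≤ N → a' ≤ N → Dec (R a a'))
           (rank : ℕ → ℕ) (decreasing : ∀ {a a'} → a ≤ N → a' ≤ N → R a a' → rank a' < rank a) where

    private
      Reach-fuel : ∀ fuel a → a ≤ N → rank a < fuel → Dec (Reach Base R b a)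
      Reach-fuel (suc fuel) a l (s≤s g) with a ≟ b ×-dec base?
      ... | yes (refl , v) = yes (here v)
      ... | no ¬here with anyUpTo? successor? (suc N)
        where
        successor? : ∀ a' → Dec (a' ≤ N × R a a' × Reach Base R b a')
        successor? a' with a' ≤? N
        ... | no ¬l' = no (¬l' ∘ proj₁)
        ... | yes l' with R? l l'
        ... | no ¬r = no (¬r ∘ proj₁ ∘ proj₂)
        ... | yes r with Reach-fuel fuel a' l' (<-≤-trans (decreasing l l' r) g)
        ... | yes v = yes (l' , r , v)
        ... | no ¬v = no (¬v ∘ proj₂ ∘ proj₂)
      ... | yes (a' , _ , l' , r , v) = yes (there l l' r v)
      ... | no ¬there = no λ
        { (here v) → ¬here (refl , v)
        ; (there _ l' r v) → ¬there (_ , s≤s l' , l' , r , v) }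

    -- Steps strictly lower the rank, so the search for a successor in the set is well-founded.
    Reach? : ∀ a → Dec (a ≤ N × Reach Base R b a)
    Reach? a with a ≤? N
    ... | no ¬l = no (¬l ∘ proj₁)
    ... | yes l = map′ (l ,_) proj₂ (Reach-fuel _ a l ≤-refl)

  -- One direction instantiates the quantified set with `Reach` itself, turned into a Boolean
  -- function; the other is induction on `Reach`.
  reach-correct : (base : Fm k m f (suc s)) (b : Fin f) (step : Fm k m (suc (suc f)) (suc s)) (x : Fin f)
    {ρ : Vec ℕ f} {σ : Vec (ℕ → Bool) s} {Base : Set} {R : ℕ → ℕ → Set} → InRange ρ →
    (∀ X → ⟦ base ⟧ ρ (X ∷ σ) ⇔ Base) →
    (∀ X {a a'} → a ≤ N → a' ≤ N → ⟦ step ⟧ (a' ∷ a ∷ ρ) (X ∷ σ) ⇔ R a a') →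
    (rank : ℕ → ℕ) → (∀ {a a'} → a ≤ N → a' ≤ N → R a a' → rank a' < rank a) →
    ⟦ reach {k} M base b step x ⟧ ρ σ ⇔ Reach Base R (lookup ρ b) (lookup ρ x)
  reach-correct base b step x {ρ} {σ} {Base} {R} inRange eb es rank decreasing = mk⇔ fwd bwd
    where
    -- Any set would do for deciding `base` and `step`, since `eb` and `es` hold for every one.
    ∅ : ℕ → Bool
    ∅ _ = false
    base? : Dec Base
    base? = map′ (to (eb ∅)) (from (eb ∅)) (⟦ base ⟧? inRange)
    R? : ∀ {a a'} → a ≤ N → a' ≤ N → Dec (R a a')
    R? l l' = map′ (to (es ∅ l l')) (from (es ∅ l l')) (⟦ step ⟧? (l' ∷ l ∷ inRange))
    D : ∀ a → Dec (a ≤ N × Reach Base R (lookup ρ b) a)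
    D = Reach? base? R? rank decreasing
    X : ℕ → Bool
    X a = ⌊ D a ⌋
    fwd : ⟦ reach {k} M base b step x ⟧ ρ σ → Reach Base R (lookup ρ b) (lookup ρ x)
    fwd v = proj₂ (toWitness (v X
      (λ vb → fromWitness (lookup⁺ inRange b , here (to (eb X) vb)))
      (λ a l a' l' vs v' → fromWitness (l , there l l' (to (es X l l') vs) (proj₂ (toWitness v'))))))
    bwd : Reach Base R (lookup ρ b) (lookup ρ x) → ⟦ reach {k} M base b step x ⟧ ρ σ
    bwd r Y vb closed = go r
      where
      go : ∀ {a} → Reach Base R (lookup ρ b) a → T (Y a)
      go (here v) = vb (from (eb Y) v)
      go (there l l' v r') = closed _ l _ l' (from (es Y l l') v) (go r')

  χ-bounds : ∀ {i j} → χ i j → i ≤ N × j ≤ N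
  χ-bounds (l , c) = ≤-trans (<⇒≤ (<⇒≤ l)) (Chain-bound c) , Chain-bound c

  Chain⇔χ : ∀ {i j} → Chain i j ⇔ χ i j
  Chain⇔χ = mk⇔ Chain⇒χ proj₂

  χ-< : ∀ {i j} → χ i j → i < j
  χ-< (l , _) = <⇒≤ l

  ≤⇔≯ : ∀ {i j} → (¬ (j < i)) ⇔ (i ≤ j)
  ≤⇔≯ = mk⇔ ≮⇒≥ ≤⇒≯

  next-correct : ∀ x y {ρ : Vec ℕ f} {σ : Vec (ℕ → Bool) s} → InRange ρ →
    ⟦ next M x y ⟧ ρ σ ⇔ lookup ρ y ≡ suc (lookup ρ x)
  next-correct x y {ρ} R = mk⇔
    (λ (l , v) → ≤-antisym (≮⇒≥ λ g → v _ (≤-trans (<⇒≤ g) (lookup⁺ R y)) (≤-refl , g)) l)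
    (λ e → ≤-reflexive (≡-sym e) , λ i _ (g , l) → contradiction (subst (i <_) e l) (≤⇒≯ g))

  inK-correct : ∀ Π b x h (ρ : Vec ℕ f) (σ : Vec (ℕ → Bool) s) →
    ⟦ inK M Π b x h ⟧ ρ σ ⇔ K Π (lookup ρ b) (lookup ρ x) (lookup ρ h)
  inK-correct Π b x h ρ σ = ≤⇔≯ ×-⇔ Chain⇔χ ×-⇔ T-inΠ Π _

  sumStep-correct : ∀ Π b x y {ρ : Vec ℕ f} {σ : Vec (ℕ → Bool) s} → InRange ρ →
    ⟦ sumStep M Π b x y ⟧ ρ σ ⇔ SumStep Π (lookup ρ b) (lookup ρ x) (lookup ρ y)
  sumStep-correct Π b x y {ρ} {σ} R =
    (inK-correct Π b x y ρ σ ×-⇔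
       ∀≤ (λ i _ → →-cong-⇔ (inK-correct Π (suc b) (suc x) zero (i ∷ ρ) σ) ≤⇔≯)
          (λ i ¬l (_ , c , _) → contradiction (proj₂ (χ-bounds c)) ¬l))
    ⊎-⇔
    (∀≤ (λ i _ → ¬-cong-⇔ (inK-correct Π (suc b) (suc x) zero (i ∷ ρ) σ))
        (λ i ¬l (_ , c , _) → contradiction (proj₂ (χ-bounds c)) ¬l)
     ×-⇔ next-correct x y {σ = σ} R ×-⇔ T-inΠ Π _)

  hset-correct : ∀ μ h x (ρ : Vec ℕ f) (σ : Vec (ℕ → Bool) s) →
    ⟦ hset M μ h x ⟧ ρ σ ⇔ HSet μ (lookup ρ h) (lookup ρ x)
  hset-correct yieldH h x ρ σ = Chain⇔χ ×-⇔ T-is⋖ _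
  hset-correct takeH  h x ρ σ = Chain⇔χ ×-⇔ T-is⋗ _

  hstep-correct : ∀ μ h x y (ρ : Vec ℕ f) (σ : Vec (ℕ → Bool) s) →
    ⟦ hstep M μ h x y ⟧ ρ σ ⇔ HStep μ (lookup ρ h) (lookup ρ x) (lookup ρ y)
  hstep-correct yieldH h x y ρ σ =
    ∀≤ (λ i _ → →-cong-⇔ ⇔.refl (→-cong-⇔ ⇔.refl (¬-cong-⇔ Chain⇔χ)))
       (λ i ¬l _ _ c → ¬l (proj₂ (χ-bounds c)))
  hstep-correct takeH h x y ρ σ =
    ∀≤ (λ i _ → →-cong-⇔ ⇔.refl (→-cong-⇔ ⇔.refl (¬-cong-⇔ Chain⇔χ)))
       (λ i ¬l _ _ c → ¬l (proj₁ (χ-bounds c)))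

  HSet-bounds : ∀ μ {h a} → HSet μ h a → h ≤ N × a ≤ N
  HSet-bounds yieldH (c , _) = χ-bounds c
  HSet-bounds takeH  (c , _) = proj₂ (χ-bounds c) , proj₁ (χ-bounds c)

  HAnchor⇔HSet : ∀ μ {i h} → HSet μ h i ⇔ HAnchor μ i h
  HAnchor⇔HSet yieldH = ⇔.refl
  HAnchor⇔HSet takeH = ⇔.refl

  HSet⇔HNode : ∀ μ {h a} → HSet μ h a ⇔ HNode μ h a
  HSet⇔HNode yieldH = mk⇔ (λ v → proj₂ (HSet-bounds yieldH v) , v) proj₂
  HSet⇔HNode takeH  = mk⇔ (λ v → proj₂ (HSet-bounds takeH v) , v) proj₂

  module _ {Node : ℕ → Set} {S : ℕ → ℕ → Set} {φ ψ : ℕ → Set} where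

    UPath-start : ∀ {b a} → UPath Node S φ ψ b a → Node a
    UPath-start (uend v _) = v
    UPath-start (ucons v _ _ _ _) = v

    UPath-end : ∀ {b a} → UPath Node S φ ψ b a → Node b
    UPath-end (uend v _) = v
    UPath-end (ucons _ _ _ _ r) = UPath-end r

    SPath-start : ∀ {a b} → SPath Node S φ ψ a b → Node a
    SPath-start (sstart v _) = v
    SPath-start (ssnoc r _ _ _ _) = SPath-start r

  module _ {Node : ℕ → Set} {S : ℕ → ℕ → Set} {φ ψ : ℕ → Set} (inWord : ∀ {a} → Node a → a ≤ N) where

    Reach⇔UPath : ∀ {b a} →
      Reach (Node b × ψ b) (λ a a' → Node a × φ a × a < a' × S a a') b a ⇔ UPath Node S φ ψ b a
    Reach⇔UPath = mk⇔ fwd bwd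
      where
      fwd : ∀ {b a} → Reach (Node b × ψ b) (λ a a' → Node a × φ a × a < a' × S a a') b a → UPath Node S φ ψ b a
      fwd (here (v , q)) = uend v q
      fwd (there _ _ (v , p , l , st) r) = ucons v p l st (fwd r)
      bwd : ∀ {b a} → UPath Node S φ ψ b a → Reach (Node b × ψ b) (λ a a' → Node a × φ a × a < a' × S a a') b a
      bwd (uend v q) = here (v , q)
      bwd (ucons v p l st r) = there (inWord v) (inWord (UPath-start r)) (v , p , l , st) (bwd r)

    -- `SPath` grows at its last position, so reading it from the outside walks backwards, and
    -- `there` matches `ssnoc`.
    Reach⇔SPath : ∀ {a b} →
      Reach (Node a × ψ a) (λ b b' → Node b × φ b × b' < b × S b' b) a b ⇔ SPath Node S φ ψ a b
    Reach⇔SPath = mk⇔ fwd bwd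
      where
      fwd : ∀ {a b} → Reach (Node a × ψ a) (λ b b' → Node b × φ b × b' < b × S b' b) a b → SPath Node S φ ψ a b
      fwd (here (v , q)) = sstart v q
      fwd (there _ _ (v , p , l , st) r) = ssnoc (fwd r) l st v p
      bwd : ∀ {a b} → SPath Node S φ ψ a b → Reach (Node a × ψ a) (λ b b' → Node b × φ b × b' < b × S b' b) a b
      bwd (sstart v q) = here (v , q)
      bwd (ssnoc r l st v p) = there (inWord v) (≤-trans (<⇒≤ l) (inWord v)) (v , p , l , st) (bwd r)

  HNode-bounds : ∀ μ {h a} → HNode μ h a → h ≤ N × a ≤ N
  HNode-bounds μ = HSet-bounds μ ∘ from (HSet⇔HNode μ)

  ×-given : {A B C : Set} → A → B ⇔ C → B ⇔ (A × C)
  ×-given a e = mk⇔ (λ b → a , to e b) (from e ∘ proj₂)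

  holds-correct : ∀ a i → T (holds a (at i)) ⇔ Sat (atom a) i
  holds-correct (inj₁ a) i with at i
  ... | just (sym _) = ⇔.refl
  ... | just hash = ⇔.refl
  ... | nothing = ⇔.refl
  holds-correct (inj₂ a) i with at i
  ... | just (sym _) = ⇔.refl
  ... | just hash = ⇔.refl
  ... | nothing = ⇔.refl

  back-correct : ∀ Π φ i → (∃ λ j → i ≡ suc j × RelΠ j Π i × Sat φ j) ⇔ Sat (backΠ Π φ) i
  back-correct Π φ zero = mk⇔ (λ { (_ , () , _) }) (λ ())
  back-correct Π φ (suc i) = mk⇔ (λ { (_ , refl , v) → v }) (λ v → i , refl , v)

  translate-correct : ∀ φ x {ρ : Vec ℕ f} {σ : Vec (ℕ → Bool) s} → InRange ρ →
    ⟦ translate M φ x ⟧ ρ σ ⇔ Sat φ (lookup ρ x)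
  translate-correct (atom a) x {ρ} R = holds-correct a (lookup ρ x)
  translate-correct (¬F φ) x R = ¬-cong-⇔ (translate-correct φ x R)
  translate-correct (φ ∨F ψ) x R = translate-correct φ x R ⊎-⇔ translate-correct ψ x R
  translate-correct (nextΠ Π φ) x {ρ} {σ} R =
    ⇔.trans
      (∃≤ (λ j l → next-correct (suc x) zero {j ∷ ρ} {σ} (l ∷ R) ×-⇔ T-inΠ Π (precPos M (at (lookup ρ x)) (at j)) ×-⇔ translate-correct φ zero (l ∷ R))
          (λ { j (refl , (_ , _ , r) , _) → Rel-bound (lookup ρ x) j r }))
      (mk⇔ (λ { (_ , refl , v) → v }) (λ v → _ , refl , v))
  translate-correct (backΠ Π φ) x {ρ} {σ} R =
    ⇔.trans
      (∃≤ (λ j l → next-correct zero (suc x) {j ∷ ρ} {σ} (l ∷ R) ×-⇔ T-inΠ Π _ ×-⇔ translate-correct φ zero (l ∷ R))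
          (λ { j (e , _) → ≤-trans (n≤1+n j) (subst (_≤ N) e (lookup⁺ R x)) }))
      (back-correct Π φ (lookup ρ x))
  translate-correct (χF Π φ) x R =
    ⇔.trans
      (∃≤ (λ j l → Chain⇔χ ×-⇔ T-inΠ Π _ ×-⇔ translate-correct φ zero (l ∷ R))
          (λ j (c , _) → proj₂ (χ-bounds c)))
      (mk⇔ (λ (j , c , v) → j , χ-< c , c , v) (λ (j , _ , v) → j , v))
  translate-correct (χP Π φ) x R =
    ⇔.trans
      (∃≤ (λ j l → Chain⇔χ ×-⇔ T-inΠ Π _ ×-⇔ translate-correct φ zero (l ∷ R))
          (λ j (c , _) → proj₁ (χ-bounds c)))
      (mk⇔ (λ (j , c , v) → j , χ-< c , c , v) (λ (j , _ , v) → j , v))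
  translate-correct (Uχ Π φ ψ) x {ρ} {σ} R =
    ∃≤ (λ j l → ≤⇔≯ ×-⇔ ⇔.trans
         (reach-correct (translate M ψ #0) #0 (translate M φ #1 and lt #1 #0 and sumStep M Π #2 #1 #0)
            (suc x) (l ∷ R)
            (λ X → ×-given l (translate-correct ψ zero (l ∷ R)))
            (λ X la la' → ×-given la (translate-correct φ #1 (la' ∷ la ∷ l ∷ R) ×-⇔ ⇔.refl
                            ×-⇔ sumStep-correct Π #2 #1 #0 {σ = X ∷ σ} (la' ∷ la ∷ l ∷ R)))
            -- Until moves right, so the distance to the end marker is the rank; since moves left,
            -- and there the position itself serves.
            (N ∸_) (λ _ la' (_ , _ , g , _) → ∸-monoʳ-< g la'))
         (Reach⇔UPath id))
       (λ j (_ , r) → UPath-end r)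
  translate-correct (Sχ Π φ ψ) x {ρ} {σ} R =
    ∃≤ (λ j l → ≤⇔≯ ×-⇔ ⇔.trans
         (reach-correct (translate M ψ #0) #0
            (translate M φ #1 and lt #0 #1 and sumStep M Π (suc (suc (suc x))) #0 #1)
            (suc x) (l ∷ R)
            (λ X → ×-given l (translate-correct ψ zero (l ∷ R)))
            (λ X la la' → ×-given la (translate-correct φ #1 (la' ∷ la ∷ l ∷ R) ×-⇔ ⇔.refl
                            ×-⇔ sumStep-correct Π (suc (suc (suc x))) #0 #1 {σ = X ∷ σ} (la' ∷ la ∷ l ∷ R)))
            id (λ _ _ (_ , _ , g , _) → g))
         (Reach⇔SPath id))
       (λ j (_ , r) → SPath-start r)
  translate-correct (nextH μ φ) x {ρ} {σ} R =
    ∃≤ (λ h l → ⇔.trans (hset-correct μ zero (suc x) (h ∷ ρ) σ) (HAnchor⇔HSet μ) ×-⇔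
         ∃≤ (λ i l' → ⇔.refl ×-⇔ hset-correct μ #1 #0 (i ∷ h ∷ ρ) σ ×-⇔
               ∀≤ (λ i' _ → →-cong-⇔ ⇔.refl (→-cong-⇔ (hset-correct μ #2 #0 (i' ∷ i ∷ h ∷ ρ) σ) ≤⇔≯))
                  (λ i' ¬l _ v → contradiction (proj₂ (HSet-bounds μ v)) ¬l)
               ×-⇔ translate-correct φ zero (l' ∷ l ∷ R))
            (λ i (_ , v , _) → proj₂ (HSet-bounds μ v)))
       (λ h (v , _) → proj₁ (HSet-bounds μ (from (HAnchor⇔HSet μ) v)))
  translate-correct (backH μ φ) x {ρ} {σ} R =
    ∃≤ (λ h l → ⇔.trans (hset-correct μ zero (suc x) (h ∷ ρ) σ) (HAnchor⇔HSet μ) ×-⇔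
         ∃≤ (λ i l' → ⇔.refl ×-⇔ hset-correct μ #1 #0 (i ∷ h ∷ ρ) σ ×-⇔
               ∀≤ (λ i' _ → →-cong-⇔ ⇔.refl (→-cong-⇔ (hset-correct μ #2 #0 (i' ∷ i ∷ h ∷ ρ) σ) ≤⇔≯))
                  (λ i' ¬l _ v → contradiction (proj₂ (HSet-bounds μ v)) ¬l)
               ×-⇔ translate-correct φ zero (l' ∷ l ∷ R))
            (λ i (_ , v , _) → proj₂ (HSet-bounds μ v)))
       (λ h (v , _) → proj₁ (HSet-bounds μ (from (HAnchor⇔HSet μ) v)))
  translate-correct (UH μ φ ψ) x {ρ} {σ} R =
    ∃≤ (λ j l → ≤⇔≯ ×-⇔ ∃≤ (λ h l' → ⇔.trans
         (reach-correct (hset M μ #0 #1 and translate M ψ #1) #1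
            (hset M μ #2 #1 and translate M φ #1 and lt #1 #0 and hstep M μ #2 #1 #0)
            (suc (suc x)) (l' ∷ l ∷ R)
            (λ X → ⇔.trans (hset-correct μ #0 #1 (h ∷ j ∷ ρ) (X ∷ σ)) (HSet⇔HNode μ)
                   ×-⇔ translate-correct ψ #1 (l' ∷ l ∷ R))
            (λ X {a} {a'} la la' →
               ⇔.trans (hset-correct μ #2 #1 (a' ∷ a ∷ h ∷ j ∷ ρ) (X ∷ σ)) (HSet⇔HNode μ)
               ×-⇔ translate-correct φ #1 (la' ∷ la ∷ l' ∷ l ∷ R) ×-⇔ ⇔.refl
               ×-⇔ hstep-correct μ #2 #1 #0 (a' ∷ a ∷ h ∷ j ∷ ρ) (X ∷ σ))
            (N ∸_) (λ _ la' (_ , _ , g , _) → ∸-monoʳ-< g la'))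
         (Reach⇔UPath (proj₂ ∘ HNode-bounds μ)))
       (λ h r → proj₁ (HNode-bounds μ (UPath-end r))))
       (λ j (_ , _ , r) → proj₂ (HNode-bounds μ (UPath-end r)))
  translate-correct (SH μ φ ψ) x {ρ} {σ} R =
    ∃≤ (λ j l → ≤⇔≯ ×-⇔ ∃≤ (λ h l' → ⇔.trans
         (reach-correct (hset M μ #0 #1 and translate M ψ #1) #1
            (hset M μ #2 #1 and translate M φ #1 and lt #0 #1 and hstep M μ #2 #0 #1)
            (suc (suc x)) (l' ∷ l ∷ R)
            (λ X → ⇔.trans (hset-correct μ #0 #1 (h ∷ j ∷ ρ) (X ∷ σ)) (HSet⇔HNode μ)
                   ×-⇔ translate-correct ψ #1 (l' ∷ l ∷ R))
            (λ X {a} {a'} la la' →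
               ⇔.trans (hset-correct μ #2 #1 (a' ∷ a ∷ h ∷ j ∷ ρ) (X ∷ σ)) (HSet⇔HNode μ)
               ×-⇔ translate-correct φ #1 (la' ∷ la ∷ l' ∷ l ∷ R) ×-⇔ ⇔.refl
               ×-⇔ hstep-correct μ #2 #0 #1 (a' ∷ a ∷ h ∷ j ∷ ρ) (X ∷ σ))
            id (λ _ _ (_ , _ , g , _) → g))
         (Reach⇔SPath (proj₂ ∘ HNode-bounds μ)))
       (λ h r → proj₁ (HNode-bounds μ (SPath-start r))))
       (λ j (_ , _ , r) → proj₂ (HNode-bounds μ (SPath-start r)))

-- The logic has no constants: position 1 is pinned down as the successor of a position with nothing
-- below it. On the empty word it is the right end marker, as in the semantics.
sentence : ∀ {k m} → Mat m → Formula k m → Fm k m 0 0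
sentence M φ = ex (ex (next M zero (suc zero) and neg (ex (lt zero (suc zero)))) and translate M φ zero)

sentence-correct : ∀ {k m} (M : Mat m) (φ : Formula k m) {n} (w : Vec (Letter k m) n) →
  Semantics.Compatible M w → Logic.⟦_⟧ M w (sentence M φ) [] [] ⇔ Semantics.Sat M w φ 1
sentence-correct M φ {n} w compatible = mk⇔
  (λ { (i , l , (z , lz , v , ¬below) , sat) →
       subst (Semantics.Sat M w φ) (first i l z lz v ¬below)
             (to (translate-correct φ zero {σ = []} (l ∷ [])) sat) })
  (λ sat → 1 , s≤s z≤n ,
     (0 , z≤n , from (next-correct zero (suc zero) {σ = []} (z≤n ∷ s≤s z≤n ∷ [])) refl , λ { (_ , _ , ()) })
     , from (translate-correct φ zero {σ = []} (s≤s z≤n ∷ [])) sat)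
  where
  open Translation M w compatible
  open Logic M w
  first : ∀ i → i ≤ suc n → ∀ z → z ≤ suc n → ⟦ next M zero (suc zero) ⟧ (z ∷ i ∷ []) [] →
          ¬ (∃ λ u → u ≤ suc n × u < z) → i ≡ 1
  first i l zero lz v _ = to (next-correct zero (suc zero) {σ = []} (lz ∷ l ∷ [])) v
  first i l (suc z) lz v ¬below = contradiction (0 , z≤n , s≤s z≤n) ¬below

-- From machines to operator precedence automata

module Automaton {k m : ℕ} (h : ℕ) (M : Mat m) (A : Mach (Label k m 0 0)) where
  open Mach A using (Q; finite; ini; fin) renaming (push to pushQ; shift to shiftQ; pop to popQ)

  restrict : Letter (k + h) m → Letter k m
  restrict = restrictAP {k} {h}

  letterLabel : Letter (k + h) m → Label k m 0 0
  letterLabel b = just (sym (restrict b)) , [] , []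

  hashLabel : Label k m 0 0
  hashLabel = just hash , [] , []

  private
    code = enc finite
    decode = dec finite

  -- All transition relations are graphs of total functions and there is one initial state, so the
  -- automaton is deterministic.
  opa : OPA (k + h) m
  opa = record
    { nQ = size finite
    ; init = λ q → ⌊ q F.≟ code (ini hashLabel) ⌋
    ; final = λ q → fin (decode q) hashLabel
    ; δpush = λ p b q → ⌊ q F.≟ code (pushQ (decode p) (letterLabel b)) ⌋
    ; δshift = λ p b q → ⌊ q F.≟ code (shiftQ (decode p) (letterLabel b)) ⌋
    ; δpop = λ q p r → ⌊ r F.≟ code (popQ (decode q) (decode p)) ⌋ }

  open Run M opa hiding (next)

  functional : ∀ {q r s : Fin (size finite)} → T ⌊ q F.≟ s ⌋ → T ⌊ r F.≟ s ⌋ → q ≡ r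
  functional u v = trans (toWitness u) (≡-sym (toWitness v))

  Step-deterministic : ∀ {c d e} → Step c d → Step c e → d ≡ e
  Step-deterministic (push _ u) (push _ v) rewrite functional u v = refl
  Step-deterministic (push r _) (shift r' _) with () ← just-unique r r'
  Step-deterministic (push r _) (pop r' _) with () ← just-unique r r'
  Step-deterministic (shift r _) (push r' _) with () ← just-unique r r'
  Step-deterministic (shift _ u) (shift _ v) rewrite functional u v = refl
  Step-deterministic (shift r _) (pop r' _) with () ← just-unique r r'
  Step-deterministic (pop r _) (push r' _) with () ← just-unique r r'
  Step-deterministic (pop r _) (shift r' _) with () ← just-unique r r'
  Step-deterministic (pop _ u) (pop _ v) rewrite functional u v = refl

  Steps⇒Star : ∀ {c d} → Steps c d → Star Step c d
  Steps⇒Star done = ε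
  Steps⇒Star (more r rs) = r ◅ Steps⇒Star rs

  Star⇒Steps : ∀ {c d} → Star Step c d → Steps c d
  Star⇒Steps ε = done
  Star⇒Steps (r ◅ rs) = more r (Star⇒Steps rs)

  restrictSym : Sym (k + h) m → Sym k m
  restrictSym hash = hash
  restrictSym (sym b) = sym (restrict b)

  -- Precedence sees only structural labels, which restriction leaves unchanged; so a word and its
  -- restriction trigger the same moves.
  precS-restrict : ∀ c d → precS M (restrictSym c) (restrictSym d) ≡ precS M c d
  precS-restrict hash hash = refl
  precS-restrict hash (sym _) = refl
  precS-restrict (sym _) hash = refl
  precS-restrict (sym _) (sym _) = refl

  suffix : ∀ {n} → Vec (Letter (k + h) m) n → ℕ → List (Letter (k + h) m)
  suffix v zero = toList v
  suffix [] (suc i) = []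
  suffix (_ ∷ v) (suc i) = suffix v i

  suffix-∷ : ∀ {n} (v : Vec (Letter (k + h) m) n) i {b} → atV v i ≡ just (sym b) →
             suffix v i ≡ b ∷ suffix v (suc i)
  suffix-∷ (_ ∷ v) zero refl = refl
  suffix-∷ (_ ∷ v) (suc i) e = suffix-∷ v i e

  atV-suffix : ∀ {n} (v : Vec (Letter (k + h) m) n) {i} → i ≤ n → atV v i ≡ just (Run.next M opa (suffix v i))
  atV-suffix [] {zero} _ = refl
  atV-suffix (_ ∷ v) {zero} _ = refl
  atV-suffix (_ ∷ v) {suc i} (s≤s l) = atV-suffix v l

  atV-map : ∀ {n} (v : Vec (Letter (k + h) m) n) i → atV (map restrict v) i ≡ Maybe.map restrictSym (atV v i)
  atV-map [] zero = refl
  atV-map [] (suc i) = refl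
  atV-map (_ ∷ v) zero = refl
  atV-map (_ ∷ v) (suc i) = atV-map v i

  suffix-end : ∀ {n} (v : Vec (Letter (k + h) m) n) → suffix v n ≡ []
  suffix-end [] = refl
  suffix-end (_ ∷ v) = suffix-end v

  -- Simulation of a parse by the automaton

  module _ {n} (v : Vec (Letter (k + h) m) n) where
    private
      w = map restrict v
      at′ = Semantics.at M v
    open Semantics M w
    open Evaluation M w
    open Parsing M w
    open Logic M w

    private
      lab : ℕ → Label k m 0 0
      lab = label [] []

      rest : ℕ → List (Letter (k + h) m)
      -- A dummy value: position 0 is never the next input.
      rest zero = []
      rest (suc i) = suffix v i

    at-map : ∀ i → at i ≡ Maybe.map restrictSym (at′ i)
    at-map zero = refl
    at-map (suc i) = atV-map v i

    Rel⇒prec : ∀ {i j c d π} → at′ i ≡ just c → at′ j ≡ just d → Rel i π j → precS M c d ≡ just π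
    Rel⇒prec {i} {j} {c} {d} ei ej r rewrite at-map i | at-map j | ei | ej =
      trans (≡-sym (precS-restrict c d)) r

    lift-letter : ∀ {i b} → at i ≡ just (sym b) → ∃ λ c → at′ i ≡ just (sym c) × lab i ≡ letterLabel c
    lift-letter {i} e rewrite at-map i with at′ i | e
    ... | just (sym c) | _ = c , refl , refl

    rest-∷ : ∀ {i c} → at′ i ≡ just (sym c) → rest i ≡ c ∷ rest (suc i)
    rest-∷ {suc i} e = suffix-∷ v i e

    at-rest : ∀ {i} → 0 < i → i ≤ suc n → at′ i ≡ just (Run.next M opa (rest i))
    at-rest {suc i} _ (s≤s l) = atV-suffix v l

    push-step : ∀ {i p γ q} → at′ i ≡ just (top γ) → Rel i ⋖ p →
      ∃ λ c → at′ p ≡ just (sym c) ×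
        Step ⟨ rest p , code q , γ ⟩ ⟨ rest (suc p) , code (pushQ q (lab p)) , (c , code q) ∷ γ ⟩
    push-step {i} {p} {γ} {q} ei r with lift-letter {p} (proj₂ (⋖-letter {i} {p} r))
    ... | c , ep , el rewrite rest-∷ {p} ep | el =
      c , ep , push (Rel⇒prec {i} {p} ei ep r)
        (fromWitness (cong (λ s → code (pushQ s (letterLabel c))) (≡-sym (dec-enc finite q))))

    shift-step : ∀ {i p c s γ q} → at′ i ≡ just (sym c) → Rel i ≐ p →
      ∃ λ d → at′ p ≡ just (sym d) ×
        Step ⟨ rest p , code q , (c , s) ∷ γ ⟩ ⟨ rest (suc p) , code (shiftQ q (lab p)) , (d , s) ∷ γ ⟩
    shift-step {i} {p} {q = q} ei r
      with lift-letter {p} (proj₂ (proj₂ (proj₂ (≐-letters {i} {p} r))))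
    ... | d , ep , el rewrite rest-∷ {p} ep | el =
      d , ep , shift (Rel⇒prec {i} {p} ei ep r)
        (fromWitness (cong (λ s → code (shiftQ s (letterLabel d))) (≡-sym (dec-enc finite q))))

    pop-step : ∀ {i j c γ q s} → at′ i ≡ just (sym c) → 0 < j → Rel i ⋗ j →
      Step ⟨ rest j , code q , (c , code s) ∷ γ ⟩ ⟨ rest j , code (popQ q s) , γ ⟩
    pop-step {i} {j} {q = q} {s} ei l r =
      pop (Rel⇒prec {i} {j} ei (at-rest l (Rel-bound i j r)) r)
        (fromWitness (cong₂ (λ a b → code (popQ a b)) (≡-sym (dec-enc finite q)) (≡-sym (dec-enc finite s))))

    level-run : ∀ {a i j c s γ q} (t : Parse a i j) → at′ a ≡ just (sym c) →
      ∃ λ d → at′ i ≡ just (sym d) ×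
        Star Step ⟨ rest (suc a) , code q , (c , s) ∷ γ ⟩ ⟨ rest j , code (eval A lab q t) , (d , s) ∷ γ ⟩

    -- Push, inner level and pop together restore the stack, so a chunk runs alike above a letter
    -- and above the bottom.
    chunk-run : ∀ {i p j h γ q} (t : Parse p h j) → at′ i ≡ just (top γ) → Rel i ⋖ p → Rel h ⋗ j →
      Star Step ⟨ rest p , code q , γ ⟩ ⟨ rest j , code (popQ (eval A lab (pushQ q (lab p)) t) q) , γ ⟩
    chunk-run {i} {p} {j} {h} t ei r r' with push-step {i} {p} ei r
    ... | c , ep , st with level-run t ep
    ... | d , eh , run = st ◅ run ◅◅ pop-step {h} {j} eh (≤-<-trans z≤n (start<next t)) r' ◅ ε

    level-run nil e = _ , e , ε
    level-run (shift {h = h} {j = j} t r) e with level-run t e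
    ... | d , eh , run with shift-step {h} {j} eh r
    ... | d' , ej , st = d' , ej , run ◅◅ st ◅ ε
    level-run (node {h = h} t r t' r') e with level-run t e
    ... | d , eh , run = d , eh , run ◅◅ chunk-run {h} t' eh r r'

    -- Position 0 has no symbol on the stack, so the bottom level gets its own induction; `i ≡ 0`
    -- excludes shifts, which leave a positive position on top.
    bottom-run : ∀ {i j q} (t : Parse 0 i j) → i ≡ 0 →
      Star Step ⟨ rest 1 , code q , [] ⟩ ⟨ rest j , code (eval A lab q t) , [] ⟩
    bottom-run nil _ = ε
    bottom-run (shift t _) refl with () ← start<next t
    bottom-run (node t r t' r') refl = bottom-run t refl ◅◅ chunk-run {0} t' refl r r'

    opa-correct : (t : Parse 0 0 (suc n)) → T (accept A lab t) ⇔ Accepts (toList v)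
    opa-correct t = mk⇔ fwd bwd
      where
      q : Q
      q = eval A lab (ini hashLabel) t
      run : Star Step ⟨ toList v , code (ini hashLabel) , [] ⟩ ⟨ [] , code q , [] ⟩
      run = subst (λ x → Star Step ⟨ toList v , code (ini hashLabel) , [] ⟩ ⟨ x , code q , [] ⟩)
                  (suffix-end v) (bottom-run t refl)
      eq : accept A lab t ≡ fin (decode (code q)) hashLabel
      eq = trans (accept-≡ A lab t)
                 (cong₂ fin (≡-sym (dec-enc finite q)) (cong (_, [] , []) hash-end))
      fwd : T (accept A lab t) → Accepts (toList v)
      fwd u = _ , _ , fromWitness refl , subst T eq u , Star⇒Steps run
      bwd : Accepts (toList v) → T (accept A lab t)
      bwd (qI , qF , i , f , steps) with toWitness i
      -- Both runs stop with empty input and empty stack, where no step applies, so the accepting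
      -- run ends in the state computed by `eval`.
      ... | refl with deterministic-end Step-deterministic (Steps⇒Star steps) (λ ()) run (λ ())
      ... | refl = subst T (≡-sym eq) f

-- Padding with propositions of H and final assembly

pad : ∀ {k m} h → Letter k m → Letter (k + h) m
pad h (N , S) = N ++ replicate h false , S

take-++ : ∀ {A : Set} {i j} (xs : Vec A i) (ys : Vec A j) → take i (xs ++ ys) ≡ xs
take-++ [] ys = refl
take-++ (x ∷ xs) ys = cong (x ∷_) (take-++ xs ys)

restrict-pad : ∀ {k m n} h (w : Vec (Letter k m) n) → map (restrictAP {k} {h}) (map (pad h) w) ≡ w
restrict-pad h [] = refl
restrict-pad h ((N , S) ∷ w) = cong₂ _∷_ (cong (_, S) (take-++ N _)) (restrict-pad h w)

machine⇒opa : ∀ {k m} h (M : Mat m) (A : Mach (Label k m 0 0)) (Property : ∀ {n} → Vec (Letter k m) n → Set) →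
  (∀ {n} (w : Vec (Letter k m) n) (t : Evaluation.Parse M w 0 0 (suc n)) → Semantics.Compatible M w →
     T (Evaluation.accept M w A (Logic.label M w [] []) t) ⇔ Property w) →
  Σ (OPA (k + h) m) λ B → ∀ {n} (w : Vec (Letter k m) n) → Semantics.Compatible M w →
    Property w ⇔ (Σ (Vec (Letter (k + h) m) n) λ w' → (map restrictAP w' ≡ w) × Run.Accepts M B (toList w'))
machine⇒opa {k} {m} h M A Property recognises = opa , λ w compatible → mk⇔
  (λ v → map (pad h) w , restrict-pad h w ,
     to (correct (map (pad h) w) (subst (Semantics.Compatible M) (≡-sym (restrict-pad h w)) compatible))
        (subst Property (≡-sym (restrict-pad h w)) v))
  (λ { (w' , refl , acc) → from (correct w' compatible) acc })
  where
  open Automaton h M A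
  correct : ∀ {n} (v : Vec (Letter (k + h) m) n) → Semantics.Compatible M (map restrict v) →
            Property (map restrict v) ⇔ Run.Accepts M opa (toList v)
  correct v compatible = ⇔.trans (⇔.sym (recognises (map restrict v) t compatible)) (opa-correct v t)
    where t = Parsing.parse M (map restrict v) compatible

theorem4 : (k m : ℕ) (M : Mat m) (φ : Formula k m) →
    Σ (OPA (k + numHier φ) m) λ A →
    ∀ {n} (w : Vec (Letter k m) n) → Semantics.Compatible M w →
    (Semantics.Sat M w φ 1
    ⇔ Σ (Vec (Letter (k + numHier φ) m) n) λ w' →
    (map restrictAP w' ≡ w) × Run.Accepts M A (toList w'))
theorem4 k m M φ =
  machine⇒opa (numHier φ) M (compile (sentence M φ)) (λ w → Semantics.Sat M w φ 1)
    (λ w t compatible → ⇔.trans (Logic.compile-correct M w (sentence M φ) [] t)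
                                (sentence-correct M φ w compatible))
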